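{- Let $G$ be a doubly-connected graph of order $n\ge 5$ and let $\overline G$ be its complement. Then $4\le\eta(G)+\eta(\overline G)\le 2n-5$. Moreover, up to isomorphism: (i) $\eta(G)+\eta(\overline G)=4$ if and only if $G\in\{P_5,C_5,B,H,E,F\}$; (ii) $\eta(G)+\eta(\overline G)=2n-5$ if and only if $G$ is one of $K_2(r,s)$, $\overline K_2(r,s)$ (for some integers $r,s\ge 1$), $K^s_{1,r}$, $\overline K^s_{1,r}$ (for some integers $r,s$ with $2\le s\le r-1$).
   Context: Graphs are finite, simple and undirected. A graph $G$ is doubly-connected if both $G$ and its complement $\overline G$ are connected. For a connected graph $G=(V,E)$ with distance $d$, a set $D=\{x_1,\dots,x_k\}\subseteq V$ is dominating if every vertex of $V\setminus D$ has a neighbor in $D$; it is locating if the vectors $(d(v,x_1),\dots,d(v,x_k))$, $v\in V$, are pairwise distinct. A metric-locating-dominating set is a set that is both dominating and locating, and $\eta(G)$ is the minimum cardinality of such a set. $P_5$ and $C_5$ are the path and cycle on 5 vertices. $B$ is the bull graph: a triangle with one pendant vertex attached to each of two distinct vertices of the triangle. $H=\overline{P_5}$ is the house graph (a 5-cycle with one chord). $E$ and $F=\overline E$ are the following complementary pair of graphs on 6 vertices: one of them is the house graph with an additional pendant vertex attached to a degree-2 vertex of the house not lying on its triangle, i.e. the graph with vertices $1,\dots,6$ and edges $12,23,34,41,25,35,16$... where $1,2,3,4$ is the 4-cycle, $5$ is adjacent exactly to $2,3$, and $6$ is adjacent exactly to $1$; the other is the complement of this graph. For positive integers $r,s$, $K_2(r,s)$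 is the double star obtained by joining by an edge the central vertices of the stars $K_{1,r}$ and $K_{1,s}$ (so it has $r+s+2$ vertices). For $2\le s\le r-1$, $K^s_{1,r}$ is the graph obtained from the star $K_{1,r}$ by adding a new vertex adjacent to exactly $s$ leaves of the star (so it has $r+2$ vertices). $\overline K_2(r,s)$ and $\overline K^s_{1,r}$ denote the complements of $K_2(r,s)$ and $K^s_{1,r}$. -}

module Defs where

open import Level using (0ℓ)
open import Data.Nat using (ℕ; zero; suc; _+_; _≤_; z≤n; s≤s; _<?_)
import Data.Nat as ℕ
open import Data.Nat.Properties using (n≤0⇒n≡0)
open import Data.Fin using (Fin; zero; suc; toℕ; #_; _↑ˡ_; _↑ʳ_; _≟_)
open import Data.Fin.Properties using (any?; all?)
open import Data.Fin.Subset using (Subset; _∈_; _∉_; ∣_∣; ⊤)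
open import Data.Fin.Subset.Properties using (_∈?_; anySubset?; ∈⊤)
open import Data.List using (List; []; _∷_; _++_; map; filter; allFin)
open import Data.List.Membership.Propositional using () renaming (_∈_ to _∈ˡ_)
import Data.List.Membership.DecPropositional as DecMembership
open import Data.Product using (∃; ∃-syntax; _×_; _,_; proj₁; proj₂)
open import Data.Product.Properties using (≡-dec)
open import Data.Sum using (_⊎_; inj₁; inj₂)
import Data.Sum as Sum
open import Data.Empty using (⊥-elim)
open import Function using (_∘_)
open import Function.Bundles using (_↔_; _⇔_; Inverse)
open import Relation.Binary using (Rel; Symmetric)
import Relation.Binary as Binary
open import Relation.Binary.PropositionalEquality
  using (_≡_; _≢_; refl; trans; ≢-sym)
open import Relation.Nullary using (¬_; Dec; yes; no; ¬?; map′; _×-dec_; _⊎-dec_; _→-dec_)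
import Relation.Unary as Unary

record Graph (n : ℕ) : Set₁ where
  infix 4 _~_ _~?_
  field
    _~_      : Rel (Fin n) 0ℓ
    ~-sym    : Symmetric _~_
    ~-irrefl : ∀ {v} → ¬ (v ~ v)
    _~?_     : Binary.Decidable _~_

complement : ∀ {n} → Graph n → Graph n
complement G = record
  { _~_      = λ u v → u ≢ v × ¬ (u ~ v)
  ; ~-sym    = λ (u≢v , u≁v) → ≢-sym u≢v , u≁v ∘ ~-sym
  ; ~-irrefl = λ (v≢v , _) → v≢v refl
  ; _~?_     = λ u v → ¬? (u ≟ v) ×-dec ¬? (u ~? v)
  }
  where
  open Graph G

infix 4 _≅_

record _≅_ {m n} (G : Graph m) (H : Graph n) : Set where
  private
    module G = Graph G
    module H = Graph H
  field
    bijection : Fin m ↔ Fin n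
  open Inverse bijection public using (to; from)
  field
    preserves : ∀ u v → (u G.~ v) ⇔ (to u H.~ to v)

minimum : ∀ {p} {P : Unary.Pred ℕ p} → Unary.Decidable P → (n : ℕ) → P n →
          ∃[ m ] (P m × (∀ k → P k → m ≤ k))
minimum P? zero p = zero , p , λ _ _ → z≤n
minimum {P = P} P? (suc n) p with P? zero
... | yes p₀ = zero , p₀ , λ _ _ → z≤n
... | no ¬p₀ with minimum {P = P ∘ suc} (P? ∘ suc) n p
...   | m , pₘ , least = suc m , pₘ , least′
  where
  least′ : ∀ k → P k → suc m ≤ k
  least′ zero    p₀ = ⊥-elim (¬p₀ p₀)
  least′ (suc k) pₖ = s≤s (least k pₖ)

module _ {n} (G : Graph n) where
  open Graph G

  infixr 5 _∷_

  data Walk : ℕ → Fin n → Fin n → Set where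
    []  : ∀ {v} → Walk zero v v
    _∷_ : ∀ {k u v w} → u ~ v → Walk k v w → Walk (suc k) u w

  walk? : ∀ k u v → Dec (Walk k u v)
  walk? zero    u v = map′ (λ { refl → [] }) (λ { [] → refl }) (u ≟ v)
  walk? (suc k) u w =
    map′ (λ (_ , e , p) → e ∷ p) (λ { (e ∷ p) → _ , e , p })
         (any? λ v → (u ~? v) ×-dec walk? k v w)

  Connected : Set
  Connected = ∀ u v → ∃[ k ] Walk k u v

  Dominating : Subset n → Set
  Dominating D = ∀ v → v ∉ D → ∃[ x ] (x ∈ D × v ~ x)

  module _ (conn : Connected) where

    shortest : ∀ u v → ∃[ d ] (Walk d u v × (∀ k → Walk k u v → d ≤ k))
    shortest u v =
      let k , p = conn u v in minimum (λ k → walk? k u v) k p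

    distance : Fin n → Fin n → ℕ
    distance u v = proj₁ (shortest u v)

    Locating : Subset n → Set
    Locating D = ∀ u v → (∀ x → x ∈ D → distance u x ≡ distance v x) → u ≡ v

    MetricLocatingDominating : Subset n → Set
    MetricLocatingDominating D = Dominating D × Locating D

    metricLocatingDominating? : Unary.Decidable MetricLocatingDominating
    metricLocatingDominating? D =
      (all? λ v → ¬? (v ∈? D) →-dec any? λ x → (x ∈? D) ×-dec (v ~? x))
      ×-dec
      (all? λ u → all? λ v →
        (all? λ x → (x ∈? D) →-dec (distance u x ℕ.≟ distance v x)) →-dec (u ≟ v))

    distance-refl : ∀ v → distance v v ≡ 0
    distance-refl v = n≤0⇒n≡0 (proj₂ (proj₂ (shortest v v)) 0 [])

    distance≡0⇒≡ : ∀ {u v} → distance u v ≡ 0 → u ≡ v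
    distance≡0⇒≡ {u} {v} = closed (proj₁ (proj₂ (shortest u v)))
      where
      closed : ∀ {k} → Walk k u v → k ≡ 0 → u ≡ v
      closed [] refl = refl

    ⊤-metricLocatingDominating : MetricLocatingDominating ⊤
    ⊤-metricLocatingDominating =
        (λ _ v∉⊤ → ⊥-elim (v∉⊤ ∈⊤))
      , (λ u v same → distance≡0⇒≡ (trans (same v ∈⊤) (distance-refl v)))

    η-minimum : ∃[ m ] ((∃[ D ] (MetricLocatingDominating D × ∣ D ∣ ≡ m))
                × (∀ k → ∃[ D ] (MetricLocatingDominating D × ∣ D ∣ ≡ k) → m ≤ k))
    η-minimum = minimum
      (λ k → anySubset? λ D → metricLocatingDominating? D ×-dec (∣ D ∣ ℕ.≟ k))
      ∣ ⊤ {n} ∣ (⊤ , ⊤-metricLocatingDominating , refl)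

    η : ℕ
    η = proj₁ η-minimum

record DoublyConnected {n} (G : Graph n) : Set where
  field
    connected            : Connected G
    complement-connected : Connected (complement G)

fromEdges : ∀ {n} → List (Fin n × Fin n) → Graph n
fromEdges es = record
  { _~_      = λ u v → u ≢ v × ((u , v) ∈ˡ es ⊎ (v , u) ∈ˡ es)
  ; ~-sym    = λ (u≢v , e) → ≢-sym u≢v , Sum.swap e
  ; ~-irrefl = λ (v≢v , _) → v≢v refl
  ; _~?_     = λ u v → ¬? (u ≟ v) ×-dec (((u , v) ∈ˡ? es) ⊎-dec ((v , u) ∈ˡ? es))
  }
  where
  open DecMembership (≡-dec _≟_ _≟_) using () renaming (_∈?_ to _∈ˡ?_)

P₅ : Graph 5
P₅ = fromEdges ((# 0 , # 1) ∷ (# 1 , # 2) ∷ (# 2 , # 3) ∷ (# 3 , # 4) ∷ [])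

C₅ : Graph 5
C₅ = fromEdges
  ((# 0 , # 1) ∷ (# 1 , # 2) ∷ (# 2 , # 3) ∷ (# 3 , # 4) ∷ (# 4 , # 0) ∷ [])

bull : Graph 5
bull = fromEdges
  ((# 0 , # 1) ∷ (# 1 , # 2) ∷ (# 2 , # 0) ∷ (# 0 , # 3) ∷ (# 1 , # 4) ∷ [])

house : Graph 5
house = complement P₅

-- The house on 4-cycle 0123 with roof 4 over the edge 12, and a pendant
-- vertex 5 attached to 0.
E : Graph 6
E = fromEdges
  ((# 0 , # 1) ∷ (# 1 , # 2) ∷ (# 2 , # 3) ∷ (# 3 , # 0) ∷
   (# 1 , # 4) ∷ (# 2 , # 4) ∷ (# 0 , # 5) ∷ [])

F : Graph 6
F = complement E

-- Vertices 0 and 1 are the centres of K₁,ᵣ and K₁,ₛ; then come the r leaves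
-- of the first star, then the s leaves of the second.
doubleStar : (r s : ℕ) → Graph (2 + (r + s))
doubleStar r s = fromEdges
  ( (zero , suc zero)
  ∷ map (λ (i : Fin r) → zero , 2 ↑ʳ (i ↑ˡ s)) (allFin r)
  ++ map (λ (j : Fin s) → suc zero , 2 ↑ʳ (r ↑ʳ j)) (allFin s))

-- K^s_{1,r}, meaningful for s ≤ r: vertex 0 is the centre of the star, vertex 1
-- is the added vertex, joined to the first s of the r leaves that follow.
starPlus : (r s : ℕ) → Graph (2 + r)
starPlus r s = fromEdges
  (  map (λ (i : Fin r) → zero , 2 ↑ʳ i) (allFin r)
  ++ map (λ (i : Fin r) → suc zero , 2 ↑ʳ i) (filter (λ i → toℕ i <? s) (allFin r)))

{-# OPTIONS --safe #-}
-- If the neighbourhoods of k vertices, restricted to the other vertices, are nonempty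
-- and distinct, then those k vertices may be omitted from a metric-locating-dominating
-- set, so η + k ≤ n. This condition is inherited from induced subgraphs. A doubly
-- connected graph contains an induced P₄, whose ends may be omitted. If moreover no three
-- vertices may be omitted, then by inspection of the one- and two-vertex extensions of
-- P₄ the graph arises from P₄ by replacing two vertices by independent sets of
-- false twins: the ends in the case of K₂(r,s), an end and the inner vertex at distance
-- two in the case of K^s_{1,r}. Such a graph has η = n − 2, since a twin class may lose
-- at most one vertex, and its complement has η = n − 3. In all other cases
-- η(G) + η(Ḡ) ≤ 2n − 6.
--
-- The lower bound is η ≥ 2. For the graphs with η(G) = η(Ḡ) = 2, the requirement
-- on the two pairs of vertices (in G and in Ḡ) implies a condition inherited by induced
-- subgraphs containing these vertices. Adding the remaining vertices one at a time leaves
-- the listed graphs on five and six vertices and no graph on seven vertices.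

module Submission where

open import Defs
open import Level using (0ℓ)
open import Data.Bool using (Bool; true; false; T)
import Data.Bool as Bool
open import Data.Empty using () renaming (⊥ to ⊥₀)
open import Data.Unit using (⊤; tt)
open import Data.Fin using (Fin; zero; suc; toℕ; #_; _↑ˡ_; _↑ʳ_; inject≤; splitAt; join; opposite; _≟_)
open import Data.Fin.Permutation using (↔⇒≡)
open import Data.Fin.Properties
  using (any?; all?; injective⇒≤; inject≤-injective; suc-injective; opposite-involutive;
         toℕ<n; toℕ-↑ˡ; splitAt-↑ˡ; splitAt-↑ʳ; splitAt⁻¹-↑ˡ; splitAt⁻¹-↑ʳ; splitAt-<; join-splitAt)
open import Data.Fin.Subset using (Subset; inside; outside; _∈_; _∉_; ∣_∣; ∁)
open import Data.Fin.Subset.Properties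
  using (∣∁p∣≡n∸∣p∣; x∉p⇒x∈∁p; x∈∁p⇒x∉p; ∣p∣≤n)
open import Data.List using (List; []; _∷_; [_]; concatMap; filter; allFin)
import Data.List as List
open import Data.List.Membership.Propositional using () renaming (_∈_ to _∈ˡ_)
open import Data.List.Membership.Propositional.Properties
  using (∈-++⁻; ∈-++⁺ˡ; ∈-++⁺ʳ; ∈-map⁻; ∈-map⁺; ∈-allFin; ∈-filter⁻; ∈-filter⁺)
open import Data.List.Relation.Unary.Any using (Any; here; there)
import Data.List.Relation.Unary.Any as Any
open import Data.Nat using (ℕ; zero; suc; _+_; _*_; _∸_; _≤_; _<_; z≤n; s≤s; _<?_; _≤?_)
open import Data.Nat.Properties hiding (_≟_; _<?_; _≤?_; suc-injective)
open import Data.Nat.Tactic.RingSolver using (solve-∀)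
open import Data.Product using (_×_; _,_; proj₁; proj₂; Σ; ∃-syntax)
open import Data.Sum using (_⊎_; inj₁; inj₂; [_,_]′; swap)
import Data.Sum as Sum
open import Data.Vec using (Vec; []; _∷_; lookup; tabulate; replicate; here; there)
import Data.Vec.Functional as Functional
open import Data.Vec.Properties
  using ([]=⇒lookup; lookup⇒[]=; lookup∘tabulate; lookup-replicate; tabulate-cong; ≡-dec)
open import Function using (_∘_; id; const)
open import Function.Bundles using (_⇔_; Equivalence; Inverse; mk⇔; mk⤖)
open import Function.Definitions using (Injective)
open import Function.Properties.Bijection using (⤖⇒↔)
open import Function.Properties.Inverse using (↔-sym; ↔-refl; ↔-trans)
open import Relation.Binary.PropositionalEquality
  using (_≡_; _≢_; refl; sym; trans; cong; cong₂; subst; subst₂; ≢-sym; module ≡-Reasoning)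
open import Relation.Nullary
  using (¬_; Dec; yes; no; does; proof; _because_; ¬?; map′; _×-dec_; _⊎-dec_; _→-dec_; contradiction)
open import Relation.Nullary.Decidable using (T?; decidable-stable; from-yes; does-⇔; dec-true; dec-false)
open import Relation.Unary using (Decidable; Pred)

-- Adjacency and maps between finite sets

infix 4 _~[_]_

_~[_]_ : ∀ {n} → Fin n → Graph n → Fin n → Set
u ~[ G ] v = Graph._~_ G u v

~?[_] : ∀ {n} (G : Graph n) u v → Dec (u ~[ G ] v)
~?[ G ] = Graph._~?_ G

~-sym[_] : ∀ {n} (G : Graph n) {u v} → u ~[ G ] v → v ~[ G ] u
~-sym[ G ] = Graph.~-sym G

~⇒≢ : ∀ {n} (G : Graph n) {u v} → u ~[ G ] v → u ≢ v
~⇒≢ G u~u refl = Graph.~-irrefl G u~u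

infix 4 _∉im_

_∉im_ : ∀ {k n} → Fin n → (Fin k → Fin n) → Set
v ∉im f = ∀ i → v ≢ f i

∉im? : ∀ {k n} (f : Fin k → Fin n) v → Dec (v ∉im f)
∉im? f v = all? λ i → ¬? (v ≟ f i)

im? : ∀ {k n} (f : Fin k → Fin n) v → (∃[ i ] f i ≡ v) ⊎ v ∉im f
im? f v with any? (λ i → f i ≟ v)
... | yes hit = inj₁ hit
... | no miss = inj₂ λ i v≡fi → miss (i , sym v≡fi)

∷-injective : ∀ {k n} {v : Fin n} {f : Fin k → Fin n} → v ∉im f → Injective _≡_ _≡_ f →
              Injective _≡_ _≡_ (v Functional.∷ f)
∷-injective v∉ f-inj {zero}  {zero}  _  = refl
∷-injective v∉ f-inj {zero}  {suc j} eq = contradiction eq (v∉ j)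
∷-injective v∉ f-inj {suc i} {zero}  eq = contradiction (sym eq) (v∉ i)
∷-injective v∉ f-inj {suc i} {suc j} eq = cong suc (f-inj eq)

-- Pigeonhole: a missed value prepended to f would give an injection into a smaller set.
injective⇒onto : ∀ {n} {f : Fin n → Fin n} → Injective _≡_ _≡_ f → ∀ v → ∃[ i ] f i ≡ v
injective⇒onto {f = f} f-inj v with im? f v
... | inj₁ hit = hit
... | inj₂ v∉ = contradiction (injective⇒≤ {f = v Functional.∷ f} (∷-injective v∉ f-inj)) 1+n≰n

-- Prepending the missed value u gives a bijection, so nothing else is missed. For three vertices in
-- distinct classes of P₄ this says that at most one of the four classes is not hit.
injective⇒misses-once : ∀ {n} {f : Fin n → Fin (suc n)} → Injective _≡_ _≡_ f →
                        ∀ {u v} → u ≢ v → u ∉im f → ∃[ i ] f i ≡ v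
injective⇒misses-once {f = f} f-inj {u} {v} u≢v u∉
  with injective⇒onto {f = u Functional.∷ f} (∷-injective u∉ f-inj) v
... | zero  , u≡v = contradiction u≡v u≢v
... | suc i , eq  = i , eq

-- Drives the search below: either there is a further vertex to add, or the embedded graph is
-- everything.
outsider⊎onto : ∀ {k n} (f : Fin k → Fin n) → (∃[ v ] v ∉im f) ⊎ (∀ v → ∃[ i ] f i ≡ v)
outsider⊎onto f with any? (∉im? f)
... | yes out = inj₁ out
... | no ¬out = inj₂ λ v → [ id , (λ v∉ → contradiction (v , v∉) ¬out) ]′ (im? f v)

outsider : ∀ {k n} → k < n → (f : Fin k → Fin n) → ∃[ v ] v ∉im f
outsider k<n f with outsider⊎onto f
... | inj₁ out = out
... | inj₂ hit = contradiction (injective⇒≤ {f = proj₁ ∘ hit} λ {u} {v} eq →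
        trans (sym (proj₂ (hit u))) (trans (cong f eq) (proj₂ (hit v)))) (<⇒≱ k<n)

-- Subsets of a finite set and their cardinalities

module _ {n} {P : Pred (Fin n) 0ℓ} (P? : Decidable P) where

  ⟪_⟫ : Subset n
  ⟪_⟫ = tabulate (does ∘ P?)

  ∈⟪⟫⁺ : ∀ {v} → P v → v ∈ ⟪_⟫
  ∈⟪⟫⁺ {v} p = lookup⇒[]= v _ (trans (lookup∘tabulate _ v) (yes-does (P? v) p))
    where
    yes-does : ∀ {A : Set} (A? : Dec A) → A → does A? ≡ inside
    yes-does (yes _) _ = refl
    yes-does (no ¬a) a = contradiction a ¬a

  ∈⟪⟫⁻ : ∀ {v} → v ∈ ⟪_⟫ → P v
  ∈⟪⟫⁻ {v} v∈ = does-yes (P? v) (trans (sym (lookup∘tabulate _ v)) ([]=⇒lookup v∈))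
    where
    does-yes : ∀ {A : Set} (A? : Dec A) → does A? ≡ inside → A
    does-yes (yes a) _ = a

enumerate : ∀ {n} (D : Subset n) → Σ (Fin ∣ D ∣ → Fin n) λ f →
            Injective _≡_ _≡_ f × (∀ i → f i ∈ D) × (∀ v → v ∈ D → ∃[ i ] f i ≡ v)
enumerate [] = (λ ()) , (λ { {()} }) , (λ ()) , λ _ ()
enumerate (outside ∷ D) =
  let f , f-inj , f∈ , f-onto = enumerate D in
    suc ∘ f
  , (λ e → f-inj (suc-injective e))
  , (λ i → there (f∈ i))
  , λ { (suc v) (there v∈) → let i , e = f-onto v v∈ in i , cong suc e }
enumerate (inside ∷ D) with enumerate D
... | f , f-inj , f∈ , f-onto = g , g-inj , g∈ , g-onto
  where
  g : Fin (suc ∣ D ∣) → Fin (suc _)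
  g zero    = zero
  g (suc i) = suc (f i)

  g-inj : Injective _≡_ _≡_ g
  g-inj {zero}  {zero}  _ = refl
  g-inj {zero}  {suc _} ()
  g-inj {suc _} {zero}  ()
  g-inj {suc i} {suc j} e = cong suc (f-inj (suc-injective e))

  g∈ : ∀ i → g i ∈ inside ∷ D
  g∈ zero    = here
  g∈ (suc i) = there (f∈ i)

  g-onto : ∀ v → v ∈ inside ∷ D → ∃[ i ] g i ≡ v
  g-onto zero    _          = zero , refl
  g-onto (suc v) (there v∈) = let i , e = f-onto v v∈ in suc i , cong suc e

covered⇒∣∣≤ : ∀ {k n} (D : Subset n) (f : Fin k → Fin n) →
              (∀ v → v ∈ D → ∃[ i ] f i ≡ v) → ∣ D ∣ ≤ k
covered⇒∣∣≤ D f f-onto =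
  let g , g-inj , g∈ , _ = enumerate D
      index = λ i → f-onto (g i) (g∈ i)
  in injective⇒≤ {f = proj₁ ∘ index} λ {i} {j} e →
       g-inj (trans (sym (proj₂ (index i))) (trans (cong f e) (proj₂ (index j))))

within⇒≤∣∣ : ∀ {k n} (D : Subset n) {f : Fin k → Fin n} → Injective _≡_ _≡_ f →
             (∀ i → f i ∈ D) → k ≤ ∣ D ∣
within⇒≤∣∣ D {f} f-inj f∈ =
  let g , _ , _ , g-onto = enumerate D
      index = λ i → g-onto (f i) (f∈ i)
  in injective⇒≤ {f = proj₁ ∘ index} λ {i} {j} e →
       f-inj (trans (sym (proj₂ (index i))) (trans (cong g e) (proj₂ (index j))))

avoided⇒∣∣≤ : ∀ {k n} (D : Subset n) (f : Fin k → Fin n) → Injective _≡_ _≡_ f →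
              (∀ i → f i ∉ D) → ∣ D ∣ + k ≤ n
avoided⇒∣∣≤ {k} {n} D f f-inj f∉ = begin
  ∣ D ∣ + k           ≤⟨ +-monoʳ-≤ ∣ D ∣ (within⇒≤∣∣ (∁ D) f-inj (x∉p⇒x∈∁p ∘ f∉)) ⟩
  ∣ D ∣ + ∣ ∁ D ∣     ≡⟨ cong (∣ D ∣ +_) (∣∁p∣≡n∸∣p∣ D) ⟩
  ∣ D ∣ + (n ∸ ∣ D ∣) ≡⟨ m+[n∸m]≡n (∣p∣≤n D) ⟩
  n                   ∎
  where
  open ≤-Reasoning

∣∣≤⇒avoided : ∀ {k n} (D : Subset n) → ∣ D ∣ + k ≤ n →
              Σ (Fin k → Fin n) λ f → Injective _≡_ _≡_ f × (∀ i → f i ∉ D)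
∣∣≤⇒avoided {k} {n} D h =
  let g , g-inj , g∈ , _ = enumerate (∁ D) in
    g ∘ (λ i → inject≤ i k≤)
  , (λ e → inject≤-injective k≤ k≤ _ _ (g-inj e))
  , λ i → x∈∁p⇒x∉p (g∈ (inject≤ i k≤))
  where
  k≤ : k ≤ ∣ ∁ D ∣
  k≤ = subst (k ≤_) (sym (∣∁p∣≡n∸∣p∣ D)) (m+n≤o⇒m≤o∸n k (subst (_≤ n) (+-comm ∣ D ∣ k) h))

-- Distances

walk₁ : ∀ {n} (G : Graph n) {u v} → Walk G 1 u v → u ~[ G ] v
walk₁ G (e ∷ []) = e

walk₂ : ∀ {n} (G : Graph n) {u v} → Walk G 2 u v → ∃[ w ] (u ~[ G ] w × w ~[ G ] v)
walk₂ G (e ∷ e′ ∷ []) = _ , e , e′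

module Distance {n} (G : Graph n) (conn : Connected G) where
  open Graph G

  private
    d : Fin n → Fin n → ℕ
    d = distance G conn

  distance-walk : ∀ u v → Walk G (d u v) u v
  distance-walk u v = proj₁ (proj₂ (shortest G conn u v))

  distance-least : ∀ {u v k} → Walk G k u v → d u v ≤ k
  distance-least {u} {v} p = proj₂ (proj₂ (shortest G conn u v)) _ p

  ~⇒distance≡1 : ∀ {u v} → u ~ v → d u v ≡ 1
  ~⇒distance≡1 {u} {v} e with d u v | distance-walk u v | distance-least (e ∷ [])
  ... | zero        | [] | _        = contradiction e ~-irrefl
  ... | suc zero    | _  | _        = refl
  ... | suc (suc _) | _  | s≤s ()

  distance≡1⇒~ : ∀ {u v} → d u v ≡ 1 → u ~ v
  distance≡1⇒~ {u} {v} e = walk₁ G (subst (λ k → Walk G k u v) e (distance-walk u v))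

  common⇒distance≡2 : ∀ {u v w} → u ≢ v → ¬ u ~ v → u ~ w → w ~ v → d u v ≡ 2
  common⇒distance≡2 {u} {v} u≢v u≁v e e′
    with d u v | distance-walk u v | distance-least (e ∷ e′ ∷ [])
  ... | zero              | [] | _            = contradiction refl u≢v
  ... | suc zero          | p  | _            = contradiction (walk₁ G p) u≁v
  ... | suc (suc zero)    | _  | _            = refl
  ... | suc (suc (suc _)) | _  | s≤s (s≤s ())

  distance≡2⇒common : ∀ {u v} → d u v ≡ 2 → ∃[ w ] (u ~ w × w ~ v)
  distance≡2⇒common {u} {v} e = walk₂ G (subst (λ k → Walk G k u v) e (distance-walk u v))

  -- A walk from u either avoids v as its second vertex, and then may start at v
  -- instead, or has a walk from v as its tail.
  twin-distance-≤ : ∀ {u v x} → (∀ w → w ≢ u → w ≢ v → u ~ w → v ~ w) →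
                    x ≢ u → d v x ≤ d u x
  twin-distance-≤ {u} {v} {x} twin x≢u with d u x | distance-walk u x
  ... | zero  | [] = contradiction refl x≢u
  ... | suc k | _∷_ {v = w} e p with w ≟ v
  ...   | yes refl = m≤n⇒m≤1+n (distance-least p)
  ...   | no w≢v  = distance-least (twin w (≢-sym (~⇒≢ G e)) w≢v e ∷ p)

  twin-distance : ∀ {u v x} → (∀ w → w ≢ u → w ≢ v → u ~ w ⇔ v ~ w) →
                  x ≢ u → x ≢ v → d u x ≡ d v x
  twin-distance twin x≢u x≢v = ≤-antisym
    (twin-distance-≤ (λ w w≢v w≢u → Equivalence.from (twin w w≢u w≢v)) x≢v)
    (twin-distance-≤ (λ w w≢u w≢v → Equivalence.to (twin w w≢u w≢v)) x≢u)

  private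
    MLD : Subset n → Set
    MLD = MetricLocatingDominating G conn

  η≤ : ∀ {D} → MLD D → η G conn ≤ ∣ D ∣
  η≤ {D} mld = proj₂ (proj₂ (η-minimum G conn)) _ (D , mld , refl)

  η-attained : ∃[ D ] (MLD D × ∣ D ∣ ≡ η G conn)
  η-attained = proj₁ (proj₂ (η-minimum G conn))

  ≤η : ∀ {k} → (∀ D → MLD D → k ≤ ∣ D ∣) → k ≤ η G conn
  ≤η bound = let D , mld , e = η-attained in subst (_ ≤_) e (bound D mld)

  -- If {x} is dominating, then all other vertices have distance 1 to x.
  2≤η : 3 ≤ n → 2 ≤ η G conn
  2≤η 3≤n = ≤η λ D mld → ≮⇒≥ λ ∣D∣<2 →
    small D mld ∣D∣<2 (∣∣≤⇒avoided D (≤-trans (+-monoˡ-≤ 2 (≤-pred ∣D∣<2)) 3≤n))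
    where
    unique : ∀ (D : Subset n) → ∣ D ∣ < 2 → ∀ {x y} → x ∈ D → y ∈ D → x ≡ y
    unique D ∣D∣<2 {x} {y} x∈ y∈ with ∣ D ∣ | enumerate D | ∣D∣<2
    ... | zero     | f , _ , _ , f-onto | _ = contradiction (proj₁ (f-onto x x∈)) λ ()
    ... | suc zero | f , _ , _ , f-onto | _ with f-onto x x∈ | f-onto y y∈
    ...   | zero , ex | zero , ey = trans (sym ex) ey
    unique D ∣D∣<2 {x} {y} x∈ y∈ | suc (suc _) | _ | s≤s (s≤s ())

    small : ∀ D → MLD D → ∣ D ∣ < 2 →
            Σ (Fin 2 → Fin n) (λ f → Injective _≡_ _≡_ f × (∀ i → f i ∉ D)) → ⊥₀
    small D (dom , loc) ∣D∣<2 (f , f-inj , f∉) =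
      0≢1+n (cong toℕ (f-inj {# 0} {# 1} (loc _ _ λ x x∈ →
        trans (dist1 (# 0) x x∈) (sym (dist1 (# 1) x x∈)))))
      where
      dist1 : ∀ i x → x ∈ D → d (f i) x ≡ 1
      dist1 i x x∈ = let y , y∈ , e = dom (f i) (f∉ i)
                     in ~⇒distance≡1 (subst (f i ~_) (unique D ∣D∣<2 y∈ x∈) e)

-- Induced subgraphs, isomorphisms and complements

record Embedding {k n} (H : Graph k) (G : Graph n) : Set where
  field
    map       : Fin k → Fin n
    injective : ∀ {u v} → map u ≡ map v → u ≡ v
    preserve  : ∀ {u v} → u ~[ H ] v → map u ~[ G ] map v
    reflect   : ∀ {u v} → map u ~[ G ] map v → u ~[ H ] v

open Embedding

∘-embedding : ∀ {j k n} {F : Graph j} {H : Graph k} {G : Graph n} →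
              Embedding H G → Embedding F H → Embedding F G
∘-embedding e f = record
  { map       = map e ∘ map f
  ; injective = injective f ∘ injective e
  ; preserve  = preserve e ∘ preserve f
  ; reflect   = reflect f ∘ reflect e
  }

complement-embedding : ∀ {k n} {H : Graph k} {G : Graph n} →
                       Embedding H G → Embedding (complement H) (complement G)
complement-embedding e = record
  { map       = map e
  ; injective = injective e
  ; preserve  = λ (u≢v , u≁v) → u≢v ∘ injective e , u≁v ∘ reflect e
  ; reflect   = λ (u≢v , u≁v) → u≢v ∘ cong (map e) , u≁v ∘ preserve e
  }

≅⇒embedding : ∀ {k n} {H : Graph k} {G : Graph n} → H ≅ G → Embedding H G
≅⇒embedding iso = record
  { map       = to
  ; injective = λ {u} {v} e → trans (sym (Inverse.strictlyInverseʳ bijection u))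
                              (trans (cong from e) (Inverse.strictlyInverseʳ bijection v))
  ; preserve  = λ {u} {v} → Equivalence.to (preserves u v)
  ; reflect   = λ {u} {v} → Equivalence.from (preserves u v)
  }
  where open _≅_ iso

surjective⇒≅ : ∀ {k n} {H : Graph k} {G : Graph n} (e : Embedding H G) →
               (∀ v → ∃[ u ] map e u ≡ v) → H ≅ G
surjective⇒≅ e onto = record
  { bijection = ⤖⇒↔ (mk⤖ (injective e , λ v → let u , eq = onto v in u , λ { refl → eq }))
  ; preserves = λ u v → mk⇔ (preserve e) (reflect e)
  }

≅-sym : ∀ {k n} {H : Graph k} {G : Graph n} → H ≅ G → G ≅ H
≅-sym {H = H} {G = G} iso = record
  { bijection = ↔-sym bijection
  ; preserves = λ u v → mk⇔
      (λ e → reflect emb (subst₂ (_~[ G ]_) (sym (inv u)) (sym (inv v)) e))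
      (λ e → subst₂ (_~[ G ]_) (inv u) (inv v) (preserve emb e))
  }
  where
  open _≅_ iso
  emb = ≅⇒embedding iso
  inv : ∀ u → to (from u) ≡ u
  inv u = Inverse.strictlyInverseˡ bijection u

≅-trans : ∀ {j k n} {F : Graph j} {H : Graph k} {G : Graph n} → F ≅ H → H ≅ G → F ≅ G
≅-trans F≅H H≅G = record
  { bijection = ↔-trans (_≅_.bijection F≅H) (_≅_.bijection H≅G)
  ; preserves = λ u v → mk⇔ (preserve e) (reflect e)
  }
  where
  e = ∘-embedding (≅⇒embedding H≅G) (≅⇒embedding F≅H)

complement-≅ : ∀ {k n} {H : Graph k} {G : Graph n} → H ≅ G → complement H ≅ complement G
complement-≅ H≅G = record
  { bijection = _≅_.bijection H≅G
  ; preserves = λ u v → mk⇔ (preserve e) (reflect e)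
  }
  where
  e = complement-embedding (≅⇒embedding H≅G)

complement-complement-≅ : ∀ {n} (G : Graph n) → complement (complement G) ≅ G
complement-complement-≅ G = record
  { bijection = ↔-refl
  ; preserves = λ u v → mk⇔
      (λ (u≢v , ¬u≁v) → decidable-stable (~?[ G ] u v) λ u≁v → ¬u≁v (u≢v , u≁v))
      (λ e → ~⇒≢ G e , λ (_ , u≁v) → u≁v e)
  }

infix 4 _⇌_

-- A symmetric form of "H is the complement of G". It treats a graph and its complement alike,
-- although a double complement returns the graph only up to isomorphism.
record _⇌_ {n} (G H : Graph n) : Set where
  field
    co⁺ : ∀ {u v} → u ≢ v → ¬ u ~[ G ] v → u ~[ H ] v
    co⁻ : ∀ {u v} → u ~[ H ] v → ¬ u ~[ G ] v

⇌-complement : ∀ {n} (G : Graph n) → G ⇌ complement G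
⇌-complement G = record { co⁺ = _,_ ; co⁻ = proj₂ }

⇌-sym : ∀ {n} {G H : Graph n} → G ⇌ H → H ⇌ G
⇌-sym {G = G} G⇌H = record
  { co⁺ = λ {u} {v} u≢v u≁v → decidable-stable (~?[ G ] u v) (u≁v ∘ co⁺ u≢v)
  ; co⁻ = λ e e′ → co⁻ e′ e
  }
  where open _⇌_ G⇌H

⇌⇒embedding : ∀ {n} {G H : Graph n} → G ⇌ H → Embedding (complement G) H
⇌⇒embedding {H = H} G⇌H = record
  { map       = id
  ; injective = id
  ; preserve  = λ (u≢v , u≁v) → co⁺ u≢v u≁v
  ; reflect   = λ e → ~⇒≢ H e , co⁻ e
  }
  where open _⇌_ G⇌H

-- Extension of a graph by one vertex

infixl 5 _▸_

-- The new vertex gets index 0 and the old ones are shifted. Boolean rows make the extensions of a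
-- graph finitely many, so that they can be checked exhaustively.
_▸_ : ∀ {k} → Graph k → Vec Bool k → Graph (suc k)
_▸_ {k} H r = record
  { _~_      = _~_
  ; ~-sym    = λ {u} {v} → ~-sym u v
  ; ~-irrefl = λ {v} → ~-irrefl v
  ; _~?_     = _~?_
  }
  where
  _~_ : Fin (suc k) → Fin (suc k) → Set
  zero  ~ zero  = ⊥₀
  zero  ~ suc v = T (lookup r v)
  suc u ~ zero  = T (lookup r u)
  suc u ~ suc v = u ~[ H ] v

  ~-sym : ∀ u v → u ~ v → v ~ u
  ~-sym zero    (suc v) e = e
  ~-sym (suc u) zero    e = e
  ~-sym (suc u) (suc v) e = ~-sym[ H ] e

  ~-irrefl : ∀ v → ¬ v ~ v
  ~-irrefl (suc v) = Graph.~-irrefl H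

  _~?_ : ∀ u v → Dec (u ~ v)
  zero  ~? zero  = no λ ()
  zero  ~? suc v = T? (lookup r v)
  suc u ~? zero  = T? (lookup r u)
  suc u ~? suc v = ~?[ H ] u v

module _ {k n} {H : Graph k} {G : Graph n} (e : Embedding H G) (v : Fin n) where

  neighbours : Vec Bool k
  neighbours = tabulate (λ i → does (~?[ G ] v (map e i)))

  neighbours⁺ : ∀ {i} → v ~[ G ] map e i → T (lookup neighbours i)
  neighbours⁺ {i} p rewrite lookup∘tabulate (λ i → does (~?[ G ] v (map e i))) i
    with ~?[ G ] v (map e i)
  ... | yes _ = tt
  ... | no ¬p = ¬p p

  neighbours⁻ : ∀ {i} → T (lookup neighbours i) → v ~[ G ] map e i
  neighbours⁻ {i} t rewrite lookup∘tabulate (λ i → does (~?[ G ] v (map e i))) i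
    with ~?[ G ] v (map e i)
  ... | yes p = p

  -- The recorded row is what makes the larger map reflect adjacency. Hence a check over all rows
  -- covers every way of attaching one more vertex of G.
  extend : v ∉im map e → Embedding (H ▸ neighbours) G
  extend v∉ = record
    { map       = f
    ; injective = ∷-injective v∉ (injective e)
    ; preserve  = λ {i} {j} → f-preserve i j
    ; reflect   = λ {i} {j} → f-reflect i j
    }
    where
    f : Fin (suc k) → Fin n
    f = v Functional.∷ map e

    f-preserve : ∀ i j → i ~[ H ▸ neighbours ] j → f i ~[ G ] f j
    f-preserve zero    (suc j) t = neighbours⁻ t
    f-preserve (suc i) zero    t = ~-sym[ G ] (neighbours⁻ t)
    f-preserve (suc i) (suc j) p = preserve e p

    f-reflect : ∀ i j → f i ~[ G ] f j → i ~[ H ▸ neighbours ] j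
    f-reflect zero    zero    p = Graph.~-irrefl G p
    f-reflect zero    (suc j) p = neighbours⁺ p
    f-reflect (suc i) zero    p = neighbours⁺ (~-sym[ G ] p)
    f-reflect (suc i) (suc j) p = reflect e p

∀vec? : ∀ {k} {P : Pred (Vec Bool k) 0ℓ} → Decidable P → Dec (∀ r → P r)
∀vec? {zero}  P? = map′ (λ { p [] → p }) (λ p → p []) (P? [])
∀vec? {suc k} P? = map′
  (λ { (pf , pt) (false ∷ r) → pf r ; (pf , pt) (true ∷ r) → pt r })
  (λ p → (λ r → p (false ∷ r)) , (λ r → p (true ∷ r)))
  (∀vec? (P? ∘ (false ∷_)) ×-dec ∀vec? (P? ∘ (true ∷_)))

-- Omitting vertices from a metric-locating-dominating set

module _ {n} (G : Graph n) where
  open Graph G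

  Differ : Fin n → Fin n → Fin n → Set
  Differ u v w = (u ~ w × ¬ v ~ w) ⊎ (¬ u ~ w × v ~ w)

  -- The witnesses lie outside the image of f, hence among the vertices kept. They concern adjacency
  -- and not distance, because distances may shrink when an induced subgraph is enlarged.
  Omittable : ∀ {k} → (Fin k → Fin n) → Set
  Omittable f = (∀ i → ∃[ w ] (w ∉im f × f i ~ w))
              × (∀ i j → i ≢ j → ∃[ w ] (w ∉im f × Differ (f i) (f j) w))

  omittable? : ∀ {k} (f : Fin k → Fin n) → Dec (Omittable f)
  omittable? f =
          (all? λ i → any? λ w → ∉im? f w ×-dec (f i ~? w))
    ×-dec (all? λ i → all? λ j → ¬? (i ≟ j) →-dec any? λ w → ∉im? f w ×-dec
            (((f i ~? w) ×-dec ¬? (f j ~? w)) ⊎-dec (¬? (f i ~? w) ×-dec (f j ~? w))))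

  GoodTriple : Set
  GoodTriple = ∃[ x ] ∃[ y ] ∃[ z ] Omittable (lookup (x ∷ y ∷ z ∷ []))

  goodTriple? : Dec GoodTriple
  goodTriple? = any? λ x → any? λ y → any? λ z → omittable? (lookup (x ∷ y ∷ z ∷ []))

omittable-embedding : ∀ {j k n} {H : Graph k} {G : Graph n} (e : Embedding H G)
                      {f : Fin j → Fin k} → Omittable H f → Omittable G (map e ∘ f)
omittable-embedding e (dom , sep) =
    (λ i → let w , w∉ , p = dom i in map e w , (λ j → w∉ j ∘ injective e) , preserve e p)
  , (λ i j i≢j → let w , w∉ , s = sep i j i≢j in
       map e w , (λ j → w∉ j ∘ injective e)
     , Sum.map (λ (p , q) → preserve e p , q ∘ reflect e)
               (λ (p , q) → p ∘ reflect e , preserve e q) s)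

omittable-cong : ∀ {k n} {G : Graph n} {f g : Fin k → Fin n} → (∀ i → f i ≡ g i) →
                 Omittable G f → Omittable G g
omittable-cong {G = G} f≗g (dom , sep) =
    (λ i → let w , w∉ , p = dom i in
       w , (λ j e → w∉ j (trans e (sym (f≗g j)))) , subst (λ u → u ~[ G ] w) (f≗g i) p)
  , (λ i j i≢j → let w , w∉ , s = sep i j i≢j in
       w , (λ j e → w∉ j (trans e (sym (f≗g j))))
     , subst₂ (λ u v → Differ G u v w) (f≗g i) (f≗g j) s)

goodTriple-embedding : ∀ {k n} {H : Graph k} {G : Graph n} → Embedding H G →
                       GoodTriple H → GoodTriple G
goodTriple-embedding {G = G} e (x , y , z , o) =
  _ , _ , _ , omittable-cong {G = G} (λ { zero → refl ; (suc zero) → refl ; (suc (suc zero)) → refl })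
                             (omittable-embedding e o)

-- Keep all other vertices. A kept vertex is the only one at distance 0 from itself, and of two
-- omitted ones exactly one is at distance 1 from their separating vertex.
omittable⇒η : ∀ {k n} (G : Graph n) (conn : Connected G) {f : Fin k → Fin n} →
              Omittable G f → η G conn + k ≤ n
omittable⇒η {k} {n} G conn {f} (dom , sep) =
  ≤-trans (+-monoˡ-≤ k (η≤ (dominating , locating))) (avoided⇒∣∣≤ D f f-inj λ i i∈ → ∈⟪⟫⁻ (∉im? f) i∈ i refl)
  where
  open Distance G conn
  open Graph G

  D : Subset n
  D = ⟪ ∉im? f ⟫

  -- Equal values could not be separated by any vertex.
  f-inj : Injective _≡_ _≡_ f
  f-inj {i} {j} e with i ≟ j
  ... | yes i≡j = i≡j
  ... | no i≢j with sep i j i≢j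
  ...   | w , _ , inj₁ (p , q) = contradiction (subst (_~ w) e p) q
  ...   | w , _ , inj₂ (p , q) = contradiction (subst (_~ w) (sym e) q) p

  outside⇒im : ∀ {v} → v ∉ D → ∃[ i ] f i ≡ v
  outside⇒im {v} v∉ with im? f v
  ... | inj₁ hit = hit
  ... | inj₂ miss = contradiction (∈⟪⟫⁺ (∉im? f) miss) v∉

  dominating : Dominating G D
  dominating v v∉ with outside⇒im v∉
  ... | i , refl = let w , w∉ , p = dom i in w , ∈⟪⟫⁺ (∉im? f) w∉ , p

  locating : Locating G conn D
  locating u v same with im? f u | im? f v
  ... | inj₂ u∉ | _ = sym (distance≡0⇒≡ G conn
          (trans (sym (same u (∈⟪⟫⁺ (∉im? f) u∉))) (distance-refl G conn u)))
  ... | _ | inj₂ v∉ = distance≡0⇒≡ G conn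
          (trans (same v (∈⟪⟫⁺ (∉im? f) v∉)) (distance-refl G conn v))
  ... | inj₁ (i , refl) | inj₁ (j , refl) with i ≟ j
  ...   | yes refl = refl
  ...   | no i≢j with sep i j i≢j
  ...     | w , w∉ , inj₁ (p , q) = contradiction
              (distance≡1⇒~ (trans (sym (same w (∈⟪⟫⁺ (∉im? f) w∉))) (~⇒distance≡1 p))) q
  ...     | w , w∉ , inj₂ (p , q) = contradiction
              (distance≡1⇒~ (trans (same w (∈⟪⟫⁺ (∉im? f) w∉)) (~⇒distance≡1 q))) p

-- Induced paths on four vertices

record InducedP₄ {n} (G : Graph n) : Set where
  constructor path
  open Graph G
  field
    {a b c d} : Fin n
    a~b : a ~ b
    b~c : b ~ c
    c~d : c ~ d
    a≁c : ¬ a ~ c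
    a≁d : ¬ a ~ d
    b≁d : ¬ b ~ d

-- P₄ is self-complementary: the path a b c d of the complement becomes the path b d a c of G.
InducedP₄-complement : ∀ {n} (G : Graph n) → InducedP₄ (complement G) → InducedP₄ G
InducedP₄-complement G (path {a} {b} {c} {d} a~b b~c c~d a≁c a≁d b≁d) = path
  (stable b≁d λ { refl → a≁d a~b })
  (~-sym[ G ] (stable a≁d λ { refl → b≁d (~-sym[ complement G ] a~b) }))
  (stable a≁c λ { refl → a≁d c~d })
  (proj₂ (~-sym[ complement G ] a~b))
  (proj₂ b~c)
  (proj₂ (~-sym[ complement G ] c~d))
  where
  stable : ∀ {u v} → ¬ u ~[ complement G ] v → u ≢ v → u ~[ G ] v
  stable {u} {v} ¬co u≢v = decidable-stable (~?[ G ] u v) λ u≁v → ¬co (u≢v , u≁v)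

-- A decidable certificate of disconnectedness: `Side` is a union of components, neither empty nor
-- everything.
record Cut {n} (G : Graph n) : Set₁ where
  field
    Side     : Pred (Fin n) 0ℓ
    side?    : Decidable Side
    {inner outer} : Fin n
    inner∈   : Side inner
    outer∉   : ¬ Side outer
    no-cross : ∀ {u v} → Side u → ¬ Side v → ¬ u ~[ G ] v

connected⇒¬cut : ∀ {n} {G : Graph n} → Connected G → ¬ Cut G
connected⇒¬cut {G = G} conn cut = outer∉ (stays inner∈ (proj₂ (conn inner outer)))
  where
  open Cut cut
  stays : ∀ {k u v} → Side u → Walk G k u v → Side v
  stays s []            = s
  stays s (_∷_ {v = v} e p) with side? v
  ... | yes s′ = stays s′ p
  ... | no ¬s′ = contradiction e (no-cross s ¬s′)

delete : ∀ {n} → Graph (suc n) → Graph n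
delete G = record
  { _~_      = λ u v → suc u ~ suc v
  ; ~-sym    = ~-sym
  ; ~-irrefl = ~-irrefl
  ; _~?_     = λ u v → suc u ~? suc v
  }
  where open Graph G

-- Suppose that the deleted vertex 0 has neighbours on both sides of the cut and misses
-- a vertex y. Either y's side has an edge x y′ with 0 ~ x and 0 ≁ y′, which extends
-- through 0 to a P₄ ending on the other side, or the vertices of y's side that 0
-- misses form a cut.
cut-delete : ∀ {n} (G : Graph (suc n)) → Cut (delete G) →
             InducedP₄ G ⊎ Cut G ⊎ Cut (complement G)
cut-delete {n} G cut = go
  where
  open Graph G
  open Cut cut

  flip : Cut (delete G)
  flip = record
    { Side = λ v → ¬ Side v ; side? = λ v → ¬? (side? v)
    ; inner∈ = outer∉ ; outer∉ = λ ¬s → ¬s inner∈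
    ; no-cross = λ {u} {v} ¬s ¬¬s e → no-cross (decidable-stable (side? v) ¬¬s) ¬s (~-sym e)
    }

  isolated : (K : Cut (delete G)) → (∀ x → Cut.Side K x → ¬ zero ~ suc x) → Cut G
  isolated K unseen = record
    { Side = Side′ ; side? = side′? ; inner∈ = Cut.inner∈ K
    ; outer = zero ; outer∉ = λ () ; no-cross = λ {u} {v} → cross u v
    }
    where
    Side′ : Pred (Fin (suc n)) 0ℓ
    Side′ zero    = ⊥₀
    Side′ (suc v) = Cut.Side K v
    side′? : Decidable Side′
    side′? zero    = no λ ()
    side′? (suc v) = Cut.side? K v
    cross : ∀ u v → Side′ u → ¬ Side′ v → ¬ u ~ v
    cross (suc u) zero    s _  e = unseen u s (~-sym e)
    cross (suc u) (suc v) s ¬s e = Cut.no-cross K s ¬s e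

  module _ (K : Cut (delete G)) {y z : Fin n}
           (y∈ : Cut.Side K y) (y≁ : ¬ zero ~ suc y)
           (z∉ : ¬ Cut.Side K z) (z~ : zero ~ suc z) where
    private module K = Cut K

    missed : InducedP₄ G ⊎ Cut G ⊎ Cut (complement G)
    missed with any? (λ x → any? λ y′ → K.side? x ×-dec K.side? y′ ×-dec
                       (zero ~? suc x) ×-dec ¬? (zero ~? suc y′) ×-dec (suc x ~? suc y′))
    ... | yes (x , y′ , x∈ , y′∈ , 0~x , 0≁y′ , x~y′) = inj₁ (path
            (~-sym z~) 0~x x~y′ (K.no-cross x∈ z∉ ∘ ~-sym) (K.no-cross y′∈ z∉ ∘ ~-sym) 0≁y′)
    ... | no none = inj₂ (inj₁ (isolated record
            { Side = λ v → K.Side v × ¬ zero ~ suc v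
            ; side? = λ v → K.side? v ×-dec ¬? (zero ~? suc v)
            ; inner∈ = y∈ , y≁ ; outer∉ = z∉ ∘ proj₁
            ; no-cross = cross }
            λ x → proj₂))
      where
      cross : ∀ {u v} → K.Side u × ¬ zero ~ suc u → ¬ (K.Side v × ¬ zero ~ suc v) →
              ¬ suc u ~ suc v
      cross {u} {v} (u∈ , u≁) ¬v e with K.side? v
      ... | no v∉ = K.no-cross u∈ v∉ e
      ... | yes v∈ with zero ~? suc v
      ...   | no v≁ = ¬v (v∈ , v≁)
      ...   | yes v~ = none (v , u , v∈ , u∈ , v~ , u≁ , ~-sym e)

  go : InducedP₄ G ⊎ Cut G ⊎ Cut (complement G)
  go with any? (λ x → side? x ×-dec (zero ~? suc x))
        | any? (λ x → ¬? (side? x) ×-dec (zero ~? suc x))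
        | any? (λ y → ¬? (zero ~? suc y))
  ... | no unseen | _ | _ = inj₂ (inj₁ (isolated cut λ x s e → unseen (x , s , e)))
  ... | _ | no unseen | _ = inj₂ (inj₁ (isolated flip λ x s e → unseen (x , s , e)))
  ... | yes (x , x∈ , x~) | yes (z , z∉ , z~) | yes (y , y≁) with side? y
  ...   | yes y∈ = missed cut y∈ y≁ z∉ z~
  ...   | no y∉  = missed flip y∉ y≁ (λ ¬s → ¬s x∈) x~
  -- Vertex 0 is adjacent to all others, hence isolated in the complement.
  go | yes _ | yes _ | no dominated = inj₂ (inj₂ record
    { Side = _≡ zero ; side? = _≟ zero ; inner∈ = refl ; outer∉ = λ { () }
    ; outer = suc inner
    ; no-cross = λ { {_} {zero} refl ¬z _ → ¬z refl
                   ; {_} {suc v} refl _ (_ , ≁v) → dominated (v , ≁v) } })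

cut-complement² : ∀ {n} (G : Graph n) → Cut (complement (complement G)) → Cut G
cut-complement² G cut = record
  { Side = Side ; side? = side? ; inner∈ = inner∈ ; outer∉ = outer∉
  ; no-cross = λ s ¬s e → no-cross s ¬s (~⇒≢ G e , λ (_ , u≁v) → u≁v e) }
  where open Cut cut

cut-delete-complement : ∀ {n} (G : Graph (suc n)) → Cut (complement (delete G)) →
                        Cut (delete (complement G))
cut-delete-complement G cut = record
  { Side = Side ; side? = side? ; inner∈ = inner∈ ; outer∉ = outer∉
  ; no-cross = λ s ¬s (su≢sv , u≁v) → no-cross s ¬s (su≢sv ∘ cong suc , u≁v) }
  where open Cut cut

-- Seinsche's theorem on cographs, by induction on the order: an induced P₄ of the graph without
-- vertex 0 persists, and a cut there is treated by `cut-delete`.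
InducedP₄⊎cut : ∀ {n} → 2 ≤ n → (G : Graph n) → InducedP₄ G ⊎ Cut G ⊎ Cut (complement G)
InducedP₄⊎cut {suc zero} (s≤s ())
InducedP₄⊎cut {suc (suc zero)} _ G with ~?[ G ] zero (suc zero)
... | yes e = inj₂ (inj₂ record
        { Side = _≡ zero ; side? = _≟ zero ; inner∈ = refl ; outer∉ = λ { () } ; outer = suc zero
        ; no-cross = λ { {_} {zero} refl ¬z _ → ¬z refl ; {_} {suc zero} refl _ (_ , u≁v) → u≁v e } })
... | no ¬e = inj₂ (inj₁ record
        { Side = _≡ zero ; side? = _≟ zero ; inner∈ = refl ; outer∉ = λ { () } ; outer = suc zero
        ; no-cross = λ { {_} {zero} refl ¬z _ → ¬z refl ; {_} {suc zero} refl _ e → ¬e e } })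
InducedP₄⊎cut {suc (suc (suc n))} _ G with InducedP₄⊎cut (s≤s (s≤s z≤n)) (delete G)
... | inj₁ (path p q r x y z) = inj₁ (path p q r x y z)
... | inj₂ (inj₁ cut) = cut-delete G cut
-- The same argument in the complement; all three outcomes translate back.
... | inj₂ (inj₂ cut) with cut-delete (complement G) (cut-delete-complement G cut)
...   | inj₁ p = inj₁ (InducedP₄-complement G p)
...   | inj₂ (inj₁ cut′) = inj₂ (inj₂ cut′)
...   | inj₂ (inj₂ cut′) = inj₂ (inj₁ (cut-complement² G cut′))

doublyConnected⇒InducedP₄ : ∀ {n} {G : Graph n} → 2 ≤ n → DoublyConnected G → InducedP₄ G
doublyConnected⇒InducedP₄ {G = G} 2≤n dc with InducedP₄⊎cut 2≤n G
... | inj₁ p = p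
... | inj₂ (inj₁ cut) = contradiction cut (connected⇒¬cut (DoublyConnected.connected dc))
... | inj₂ (inj₂ cut) = contradiction cut (connected⇒¬cut (DoublyConnected.complement-connected dc))

-- Blow-ups of the four-vertex path

empty : Graph 0
empty = record { _~_ = λ _ _ → ⊥₀ ; ~-sym = id ; ~-irrefl = id ; _~?_ = λ () }

-- Each new vertex is joined to the one added just before it. As the newest vertex has index 0, the
-- path runs 0 1 2 3.
P₄ : Graph 4
P₄ = empty ▸ [] ▸ (true ∷ []) ▸ (true ∷ false ∷ []) ▸ (true ∷ false ∷ false ∷ [])

row : Fin 4 → Vec Bool 4
row k = tabulate λ i → does (~?[ P₄ ] k i)

opaque

  P₄-differ : ∀ i j → i ≢ j → ∃[ k ] Differ P₄ i j k
  P₄-differ = from-yes (all? λ i → all? λ j → ¬? (i ≟ j) →-dec any? λ k →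
    ((~?[ P₄ ] i k ×-dec ¬? (~?[ P₄ ] j k)) ⊎-dec (¬? (~?[ P₄ ] i k) ×-dec ~?[ P₄ ] j k)))

  -- P₄ has no twins, so a row determines its vertex.
  row-injective : ∀ i j → row i ≡ row j → i ≡ j
  row-injective = from-yes (all? λ i → all? λ j → ≡-dec Bool._≟_ (row i) (row j) →-dec (i ≟ j))

  row⁺ : ∀ k {i} → k ~[ P₄ ] i → T (lookup (row k) i)
  row⁺ k {i} = from-yes (all? λ k → all? λ i → ~?[ P₄ ] k i →-dec T? (lookup (row k) i)) k i

  row⁻ : ∀ k {i} → T (lookup (row k) i) → k ~[ P₄ ] i
  row⁻ k {i} = from-yes (all? λ k → all? λ i → T? (lookup (row k) i) →-dec ~?[ P₄ ] k i) k i

  neighbour-of-0 : ∀ l → # 0 ~[ P₄ ] l → l ≡ # 1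
  neighbour-of-0 = from-yes (all? λ l → ~?[ P₄ ] (# 0) l →-dec (l ≟ # 1))

  neighbour-of-1 : ∀ l → # 1 ~[ P₄ ] l → l ≡ # 0 ⊎ l ≡ # 2
  neighbour-of-1 = from-yes (all? λ l → ~?[ P₄ ] (# 1) l →-dec ((l ≟ # 0) ⊎-dec (l ≟ # 2)))

  neighbour-of-3 : ∀ l → # 3 ~[ P₄ ] l → l ≡ # 2
  neighbour-of-3 = from-yes (all? λ l → ~?[ P₄ ] (# 3) l →-dec (l ≟ # 2))

InducedP₄⇒embedding : ∀ {n} {G : Graph n} → InducedP₄ G → Embedding P₄ G
InducedP₄⇒embedding {n} {G} (path {a} {b} {c} {d} a~b b~c c~d a≁c a≁d b≁d) = record
  { map = f ; injective = λ {i} {j} → f-inj i j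
  ; preserve = λ {i} {j} → f-preserve i j ; reflect = λ {i} {j} → f-reflect i j }
  where
  open Graph G
  f : Fin 4 → Fin n
  f = lookup (a ∷ b ∷ c ∷ d ∷ [])

  f-preserve : ∀ i j → i ~[ P₄ ] j → f i ~ f j
  f-preserve zero                   (suc zero)             _ = a~b
  f-preserve (suc zero)             zero                   _ = ~-sym a~b
  f-preserve (suc zero)             (suc (suc zero))       _ = b~c
  f-preserve (suc (suc zero))       (suc zero)             _ = ~-sym b~c
  f-preserve (suc (suc zero))       (suc (suc (suc zero))) _ = c~d
  f-preserve (suc (suc (suc zero))) (suc (suc zero))       _ = ~-sym c~d

  f-preserve zero                   (suc (suc zero))       ()
  f-preserve zero                   (suc (suc (suc zero))) ()
  f-preserve (suc zero)             (suc (suc (suc zero))) ()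
  f-preserve (suc (suc (suc zero))) (suc (suc (suc zero))) ()

  f-reflect : ∀ i j → f i ~ f j → i ~[ P₄ ] j
  f-reflect zero                   (suc zero)             _ = tt
  f-reflect (suc zero)             zero                   _ = tt
  f-reflect (suc zero)             (suc (suc zero))       _ = tt
  f-reflect (suc (suc zero))       (suc zero)             _ = tt
  f-reflect (suc (suc zero))       (suc (suc (suc zero))) _ = tt
  f-reflect (suc (suc (suc zero))) (suc (suc zero))       _ = tt
  f-reflect zero                   zero                   = ~-irrefl
  f-reflect zero                   (suc (suc zero))       = a≁c
  f-reflect zero                   (suc (suc (suc zero))) = a≁d
  f-reflect (suc zero)             (suc zero)             = ~-irrefl
  f-reflect (suc zero)             (suc (suc (suc zero))) = b≁d
  f-reflect (suc (suc zero))       zero                   = a≁c ∘ ~-sym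
  f-reflect (suc (suc zero))       (suc (suc zero))       = ~-irrefl
  f-reflect (suc (suc (suc zero))) zero                   = a≁d ∘ ~-sym
  f-reflect (suc (suc (suc zero))) (suc zero)             = b≁d ∘ ~-sym
  f-reflect (suc (suc (suc zero))) (suc (suc (suc zero))) = ~-irrefl

  -- Distinct vertices of P₄ differ in adjacency to some vertex of P₄, and f carries this difference
  -- over.
  f-inj : ∀ i j → f i ≡ f j → i ≡ j
  f-inj i j e with i ≟ j
  ... | yes i≡j = i≡j
  ... | no i≢j with P₄-differ i j i≢j
  ...   | k , inj₁ (p , q) = contradiction (f-reflect j k (subst (_~ f k) e (f-preserve i k p))) q
  ...   | k , inj₂ (p , q) = contradiction (f-reflect i k (subst (_~ f k) (sym e) (f-preserve j k q))) p

-- The complement of the path 0 1 2 3 is the path 1 3 0 2.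
P₄-self-complementary : Embedding P₄ (complement P₄)
P₄-self-complementary = record
  { map       = f
  ; injective = λ {i} {j} → proj₁ (f-embeds i j)
  ; preserve  = λ {i} {j} → proj₁ (proj₂ (f-embeds i j))
  ; reflect   = λ {i} {j} → proj₂ (proj₂ (f-embeds i j))
  }
  where
  f : Fin 4 → Fin 4
  f = lookup (# 1 ∷ # 3 ∷ # 0 ∷ # 2 ∷ [])
  opaque
    f-embeds : ∀ i j → (f i ≡ f j → i ≡ j)
                     × (i ~[ P₄ ] j → f i ~[ complement P₄ ] f j)
                     × (f i ~[ complement P₄ ] f j → i ~[ P₄ ] j)
    f-embeds = from-yes (all? λ i → all? λ j → ((f i ≟ f j) →-dec (i ≟ j))
      ×-dec (~?[ P₄ ] i j →-dec ~?[ complement P₄ ] (f i) (f j))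
      ×-dec (~?[ complement P₄ ] (f i) (f j) →-dec ~?[ P₄ ] i j))

-- The ends of P₄ have different inner vertices as their only neighbours on the path.
embedding⇒η+2≤n : ∀ {n} {G : Graph n} (conn : Connected G) → Embedding P₄ G → η G conn + 2 ≤ n
embedding⇒η+2≤n {G = G} conn e = omittable⇒η G conn (omittable-embedding e ends)
  where
  opaque
    ends : Omittable P₄ (lookup (# 0 ∷ # 3 ∷ []))
    ends = from-yes (omittable? P₄ (lookup (# 0 ∷ # 3 ∷ [])))

-- Each vertex k of P₄ is replaced by the class of vertices with `κ` equal to k. Classes are
-- independent because P₄ has no loops, and nonempty because of `rep`.
record Blowup {n} (G : Graph n) : Set where
  field
    κ     : Fin n → Fin 4
    rep   : Fin 4 → Fin n
    κ-rep : ∀ k → κ (rep k) ≡ k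
    ~⇒κ   : ∀ {u v} → u ~[ G ] v → κ u ~[ P₄ ] κ v
    κ⇒~   : ∀ {u v} → κ u ~[ P₄ ] κ v → u ~[ G ] v

  Single : Fin 4 → Set
  Single x = ∀ v → κ v ≡ x → v ≡ rep x

  embedding : Embedding P₄ G
  embedding = record
    { map       = rep
    ; injective = λ {i} {j} e → trans (sym (κ-rep i)) (trans (cong κ e) (κ-rep j))
    ; preserve  = λ {i} {j} e → κ⇒~ (subst₂ (_~[ P₄ ]_) (sym (κ-rep i)) (sym (κ-rep j)) e)
    ; reflect   = λ {i} {j} e → subst₂ (_~[ P₄ ]_) (κ-rep i) (κ-rep j) (~⇒κ e)
    }

  neighbours-embedding : ∀ v → neighbours embedding v ≡ row (κ v)
  neighbours-embedding v = tabulate-cong λ i → does-⇔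
    (mk⇔ (λ e → subst (κ v ~[ P₄ ]_) (κ-rep i) (~⇒κ e))
         (λ e → κ⇒~ (subst (κ v ~[ P₄ ]_) (sym (κ-rep i)) e)))
    (~?[ G ] v (rep i)) (~?[ P₄ ] (κ v) i)

-- Reflecting the path exchanges its inner classes, so an enlarged inner class may be taken to be
-- class 1.
reverse : ∀ {n} {G : Graph n} → Blowup G → Blowup G
reverse B = record
  { κ     = opposite ∘ κ
  ; rep   = rep ∘ opposite
  ; κ-rep = λ k → trans (cong opposite (κ-rep (opposite k))) (opposite-involutive k)
  ; ~⇒κ   = λ {u} {v} e → opposite-preserve (κ u) (κ v) (~⇒κ e)
  ; κ⇒~   = λ {u} {v} e → κ⇒~ (subst₂ (_~[ P₄ ]_)
      (opposite-involutive (κ u)) (opposite-involutive (κ v))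
      (opposite-preserve (opposite (κ u)) (opposite (κ v)) e))
  }
  where
  open Blowup B
  opaque
    opposite-preserve : ∀ i j → i ~[ P₄ ] j → opposite i ~[ P₄ ] opposite j
    opposite-preserve = from-yes (all? λ i → all? λ j → ~?[ P₄ ] i j →-dec ~?[ P₄ ] (opposite i) (opposite j))

DoubleStarLike : ∀ {n} → Graph n → Set
DoubleStarLike G = Σ (Blowup G) λ B → Blowup.Single B (# 1) × Blowup.Single B (# 2)

-- Class 2 is the centre of the star, class 0 the added vertex, class 1 the leaves joined to both
-- and class 3 the other leaves. Class 1 may be a single vertex, and then the graph is a double star
-- as well.
StarPlusLike : ∀ {n} → Graph n → Set
StarPlusLike G = Σ (Blowup G) λ B → Blowup.Single B (# 0) × Blowup.Single B (# 2)

-- The checks below say that, in the absence of good triples, every further vertex is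
-- isolated from P₄ or a false twin of one of its vertices, and that the further
-- vertices form an independent set.

shape : Fin 5 → Vec Bool 4
shape zero    = replicate 4 false
shape (suc k) = row k

opaque

  one-vertex-extension : ∀ r → (∃[ k ] r ≡ shape k) ⊎ GoodTriple (P₄ ▸ r)
  one-vertex-extension = from-yes (∀vec? λ r →
    (any? λ k → ≡-dec Bool._≟_ r (shape k)) ⊎-dec goodTriple? (P₄ ▸ r))

  adjacent-extension : ∀ k l → GoodTriple (P₄ ▸ shape k ▸ (true ∷ shape l))
  adjacent-extension = from-yes (all? λ k → all? λ l → goodTriple? (P₄ ▸ shape k ▸ (true ∷ shape l)))

  -- Twins of adjacent path vertices would have to be adjacent in a blow-up, while further vertices
  -- never are. Hence only nonadjacent classes can both be enlarged.
  twin-extension : ∀ k l → ¬ l ~[ P₄ ] k ⊎ GoodTriple (P₄ ▸ row k ▸ (false ∷ row l))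
  twin-extension = from-yes (all? λ k → all? λ l →
    ¬? (~?[ P₄ ] l k) ⊎-dec goodTriple? (P₄ ▸ row k ▸ (false ∷ row l)))

  -- P₄ with one doubled vertex occurs in every blow-up of order at least 5; this provides the bound
  -- n - 3 for the complement.
  complement-extension : ∀ k → GoodTriple (complement (P₄ ▸ row k))
  complement-extension = from-yes (all? λ k → goodTriple? (complement (P₄ ▸ row k)))

-- Graphs without a good triple

connected⇒neighbour : ∀ {n} {G : Graph n} → Connected G → ∀ {u v} → u ≢ v → ∃[ w ] u ~[ G ] w
connected⇒neighbour conn {u} {v} u≢v with conn u v
... | _ , []    = contradiction refl u≢v
... | _ , e ∷ _ = _ , e

module Classify {n} {G : Graph n} (conn : Connected G) (¬good : ¬ GoodTriple G)
                (e : Embedding P₄ G) where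
  open Graph G

  private
    Outside : Fin n → Set
    Outside v = v ∉im map e

  outside-shape : ∀ {v} → Outside v → ∃[ k ] neighbours e v ≡ shape k
  outside-shape {v} v∉ with one-vertex-extension (neighbours e v)
  ... | inj₁ s    = s
  ... | inj₂ good = contradiction (goodTriple-embedding (extend e v v∉) good) ¬good

  extend₂ : ∀ {u v} (u∉ : Outside u) → Outside v → u ≢ v →
            Embedding (P₄ ▸ neighbours e u ▸ (does (v ~? u) ∷ neighbours e v)) G
  extend₂ {u} {v} u∉ v∉ u≢v = extend (extend e u u∉) v λ { zero → ≢-sym u≢v ; (suc i) → v∉ i }

  outside-independent : ∀ {u v} → Outside u → Outside v → ¬ u ~ v
  outside-independent {u} {v} u∉ v∉ u~v
    with outside-shape u∉ | outside-shape v∉ | extend₂ u∉ v∉ (~⇒≢ G u~v)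
  ... | k , ku | l , lv | e₂ = ¬good (goodTriple-embedding
          (subst (λ H → Embedding H G)
            (trans (cong (λ b → P₄ ▸ neighbours e u ▸ (b ∷ neighbours e v)) (dec-true (v ~? u) (~-sym u~v)))
                   (cong₂ (λ r s → P₄ ▸ r ▸ (true ∷ s)) ku lv))
            e₂)
          (adjacent-extension k l))

  -- Vertices off the path are pairwise nonadjacent, so one without neighbours on the path has no
  -- neighbour at all, against connectedness.
  isolated : ∀ {v} → Outside v → ¬ neighbours e v ≡ shape zero
  isolated {v} v∉ eq = let w , p = connected⇒neighbour conn (v∉ zero) in absurd w p
    where
    absurd : ∀ w → ¬ v ~ w
    absurd w p with im? (map e) w
    ... | inj₂ w∉ = outside-independent v∉ w∉ p
    ... | inj₁ (i , refl) = no-zeros i (subst (λ r → T (lookup r i)) eq (neighbours⁺ e v p))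
      where
      no-zeros : ∀ i → ¬ T (lookup (shape zero) i)
      no-zeros i t = subst T (lookup-replicate i false) t

  opaque

    class : ∀ v → ∃[ k ] neighbours e v ≡ row k
    class v with im? (map e) v
    ... | inj₁ (k , refl) = k , tabulate-cong λ i →
            does-⇔ (mk⇔ (reflect e) (preserve e)) (v ~? map e i) (~?[ P₄ ] k i)
    ... | inj₂ v∉ with outside-shape v∉
    ...   | zero  , eq = contradiction eq (isolated v∉)
    ...   | suc k , eq = k , eq

  κ : Fin n → Fin 4
  κ = proj₁ ∘ class

  κ-map : ∀ k → κ (map e k) ≡ k
  κ-map k = row-injective _ _ (trans (sym (proj₂ (class (map e k)))) (tabulate-cong λ i →
    does-⇔ (mk⇔ (reflect e) (preserve e)) (map e k ~? map e i) (~?[ P₄ ] k i)))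

  ~map⇒κ : ∀ {v i} → v ~ map e i → κ v ~[ P₄ ] i
  ~map⇒κ {v} {i} p = row⁻ (κ v) (subst (λ r → T (lookup r i)) (proj₂ (class v)) (neighbours⁺ e v p))

  κ⇒~map : ∀ {v i} → κ v ~[ P₄ ] i → v ~ map e i
  κ⇒~map {v} {i} p = neighbours⁻ e v (subst (λ r → T (lookup r i)) (sym (proj₂ (class v))) (row⁺ (κ v) p))

  outside-κ-independent : ∀ {u v} → Outside u → Outside v → ¬ κ u ~[ P₄ ] κ v
  outside-κ-independent {u} {v} u∉ v∉ p with u ≟ v
  ... | yes refl = Graph.~-irrefl P₄ {κ u} p
  ... | no u≢v with twin-extension (κ v) (κ u) | extend₂ v∉ u∉ (≢-sym u≢v)
  ...   | inj₁ ¬p   | _  = ¬p p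
  ...   | inj₂ good | e₂ = ¬good (goodTriple-embedding
          (subst (λ H → Embedding H G)
            (trans (cong (λ b → P₄ ▸ neighbours e v ▸ (b ∷ neighbours e u))
                         (dec-false (u ~? v) (outside-independent u∉ v∉)))
                   (cong₂ (λ r s → P₄ ▸ r ▸ (false ∷ s)) (proj₂ (class v)) (proj₂ (class u))))
            e₂)
          good)

  -- If one of two vertices lies on the path, their adjacency is read off from the row of the other.
  -- If neither does, they are nonadjacent, and so are their classes.
  blowup : Blowup G
  blowup = record { κ = κ ; rep = map e ; κ-rep = κ-map
                  ; ~⇒κ = λ {u} {v} → ~⇒κ u v ; κ⇒~ = λ {u} {v} → κ⇒~ u v }
    where
    ~⇒κ : ∀ u v → u ~ v → κ u ~[ P₄ ] κ v
    ~⇒κ u v p with im? (map e) u | im? (map e) v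
    ... | _ | inj₁ (i , refl) = subst (κ u ~[ P₄ ]_) (sym (κ-map i)) (~map⇒κ p)
    ... | inj₁ (i , refl) | _ =
            subst (_~[ P₄ ] κ v) (sym (κ-map i)) (~-sym[ P₄ ] {κ v} {i} (~map⇒κ (~-sym p)))
    ... | inj₂ u∉ | inj₂ v∉ = contradiction p (outside-independent u∉ v∉)

    κ⇒~ : ∀ u v → κ u ~[ P₄ ] κ v → u ~ v
    κ⇒~ u v p with im? (map e) u | im? (map e) v
    ... | _ | inj₁ (i , refl) = κ⇒~map (subst (κ u ~[ P₄ ]_) (κ-map i) p)
    ... | inj₁ (i , refl) | _ =
            ~-sym (κ⇒~map (~-sym[ P₄ ] {i} {κ v} (subst (_~[ P₄ ] κ v) (κ-map i) p)))
    ... | inj₂ u∉ | inj₂ v∉ = contradiction p (outside-κ-independent u∉ v∉)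

  open Blowup blowup using (Single)

  Extra : Fin 4 → Set
  Extra k = ∃[ v ] (κ v ≡ k × v ≢ map e k)

  extra? : ∀ k → Dec (Extra k)
  extra? k = any? λ v → (κ v ≟ k) ×-dec ¬? (v ≟ map e k)

  extra⇒outside : ∀ {v} → v ≢ map e (κ v) → Outside v
  extra⇒outside v≢ i refl = v≢ (cong (map e) (sym (κ-map i)))

  ¬extra⇒single : ∀ {k} → ¬ Extra k → Single k
  ¬extra⇒single {k} ¬ex v eq = decidable-stable (v ≟ map e k) λ v≢ → ¬ex (v , eq , v≢)

  extra⇒single : ∀ {k l} → k ~[ P₄ ] l → Extra k → Single l
  extra⇒single k~l (u , refl , u≢) = ¬extra⇒single λ { (v , refl , v≢) →
    outside-κ-independent (extra⇒outside u≢) (extra⇒outside v≢) k~l }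

  -- If class 1 is enlarged, its neighbours 0 and 2 are singletons. If class 2 is, the path is
  -- reversed. Otherwise both inner classes are singletons.
  classify : DoubleStarLike G ⊎ (Σ (StarPlusLike G) λ (B , _) →
               ∃[ v ] (Blowup.κ B v ≡ # 1 × v ≢ Blowup.rep B (# 1)))
  classify with extra? (# 1) | extra? (# 2)
  ... | yes ex₁ | _ = inj₂ ((blowup , extra⇒single {l = # 0} tt ex₁ , extra⇒single {l = # 2} tt ex₁) , ex₁)
  ... | no ¬ex₁ | no ¬ex₂ = inj₁ (blowup , ¬extra⇒single ¬ex₁ , ¬extra⇒single ¬ex₂)
  ... | no ¬ex₁ | yes ex₂@(v , eq , v≢) = inj₂
    ( ( reverse blowup
      , (λ w eq′ → extra⇒single {l = # 3} tt ex₂ w (opposite-injective (κ w) (# 3) eq′))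
      , (λ w eq′ → ¬extra⇒single ¬ex₁ w (opposite-injective (κ w) (# 1) eq′)) )
    , v , cong opposite eq , v≢ )
    where
    opposite-injective : ∀ (i j : Fin 4) → opposite i ≡ opposite j → i ≡ j
    opposite-injective i j eq′ =
      trans (sym (opposite-involutive i)) (trans (cong opposite eq′) (opposite-involutive j))

-- A fifth vertex v besides the four representatives induces with them P₄ with a twin of vertex
-- `κ v`.
blowup⇒complement-goodTriple : ∀ {n} {G H : Graph n} → 5 ≤ n → G ⇌ H → Blowup G → GoodTriple H
blowup⇒complement-goodTriple {G = G} 5≤n G⇌H B =
  let v , v∉ = outsider 5≤n rep in
  goodTriple-embedding
    (∘-embedding (⇌⇒embedding G⇌H) (complement-embedding
      (subst (λ r → Embedding (P₄ ▸ r) G) (neighbours-embedding v) (extend embedding v v∉))))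
    (complement-extension (κ v))
  where
  open Blowup B

-- Lower bounds for blow-ups

TwinSeparating : ∀ {n} → (Fin n → Fin 4) → Subset n → Set
TwinSeparating κ D = ∀ {u v} → u ∉ D → v ∉ D → κ u ≡ κ v → u ≡ v

-- Vertices outside D lie in distinct classes, so omitting k vertices means hitting k of the four
-- classes.
missed-classes : ∀ {k n} {κ : Fin n → Fin 4} (D : Subset n) → TwinSeparating κ D → ∣ D ∣ + k ≤ n →
                 Σ (Fin k → Fin n) λ f → Injective _≡_ _≡_ (κ ∘ f) × (∀ i → f i ∉ D)
missed-classes D twins h =
  let f , f-inj , f∉ = ∣∣≤⇒avoided D h in f , (λ {i} {j} eq → f-inj (twins (f∉ i) (f∉ j) eq)) , f∉

-- Lower bounds for η are obtained by refuting sets that omit one vertex more than allowed.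
≤η+ : ∀ {n} (G : Graph n) (conn : Connected G) k →
      (∀ D → MetricLocatingDominating G conn D → ¬ ∣ D ∣ + suc k ≤ n) → n ≤ η G conn + k
≤η+ {n} G conn k bound =
  let D , mld , eq = Distance.η-attained G conn in
  ≤-pred (subst (suc n ≤_) (trans (+-suc ∣ D ∣ k) (cong (λ m → suc (m + k)) eq)) (≰⇒> (bound D mld)))

module _ {n} {G : Graph n} (conn : Connected G) (B : Blowup G) where
  open Graph G
  open Blowup B
  open Distance G conn

  -- Two vertices of one class are false twins and, both being outside D, have the same distance to
  -- every vertex of D.
  blowup-twinSeparating : ∀ {D} → Locating G conn D → TwinSeparating κ D
  blowup-twinSeparating loc {u} {v} u∉ v∉ eq = loc u v λ x x∈ → twin-distance
    (λ w _ _ → mk⇔ (κ⇒~ ∘ subst (_~[ P₄ ] κ w) eq ∘ ~⇒κ) (κ⇒~ ∘ subst (_~[ P₄ ] κ w) (sym eq) ∘ ~⇒κ))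
    (λ { refl → u∉ x∈ }) (λ { refl → v∉ x∈ })

  Misses : Subset n → Fin 4 → Set
  Misses D k = ∃[ u ] (κ u ≡ k × u ∉ D)

  -- A missed vertex is undominated if each neighbouring class consists of a single vertex that is
  -- missed too.
  blocked : ∀ {D k} → Dominating G D → Misses D k →
            ¬ (∀ l → k ~[ P₄ ] l → Single l × Misses D l)
  blocked {D} dom (u , refl , u∉) nbrs with dom u u∉
  ... | x , x∈ , p with nbrs (κ x) (~⇒κ p)
  ...   | single , y , eq , y∉ = y∉ (subst (_∈ D) (trans (single _ refl) (sym (single _ eq))) x∈)

-- Three omitted vertices hit three classes, among them 0 and 1 or else 2 and 3. A leaf is then
-- omitted together with its centre and stays undominated.
doubleStarLike⇒≤η+2 : ∀ {n} {G : Graph n} (conn : Connected G) → DoubleStarLike G → n ≤ η G conn + 2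
doubleStarLike⇒≤η+2 {G = G} conn (B , single₁ , single₂) = ≤η+ G conn 2 λ D (dom , loc) h →
  let f , κf-inj , f∉ = missed-classes D (blowup-twinSeparating conn B loc) h
      misses : ∀ {k} → ∃[ i ] κ (f i) ≡ k → Misses conn B D k
      misses (i , eq) = f i , eq , f∉ i
      end₀ = λ h₀ h₁ → blocked conn B dom (misses h₀) λ l e →
               subst (λ l → Single l × Misses conn B D l) (sym (neighbour-of-0 l e)) (single₁ , misses h₁)
      end₃ = λ h₃ h₂ → blocked conn B dom (misses h₃) λ l e →
               subst (λ l → Single l × Misses conn B D l) (sym (neighbour-of-3 l e)) (single₂ , misses h₂)
  in case₃ (im? (κ ∘ f) (# 0)) (im? (κ ∘ f) (# 1)) end₀ end₃ (injective⇒misses-once κf-inj)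
  where
  open Blowup B
  -- Here h says that a class is hit by an omitted vertex, and m that it is not.
  case₃ : ∀ {h : Fin 4 → Set} {m : Fin 4 → Set} →
          h (# 0) ⊎ m (# 0) → h (# 1) ⊎ m (# 1) →
          (h (# 0) → h (# 1) → ⊥₀) → (h (# 3) → h (# 2) → ⊥₀) →
          (∀ {k l} → k ≢ l → m k → h l) → ⊥₀
  case₃ (inj₁ h₀) (inj₁ h₁) end₀ end₃ other = end₀ h₀ h₁
  case₃ (inj₂ m₀) _         end₀ end₃ other = end₃ (other (λ ()) m₀) (other (λ ()) m₀)
  case₃ _         (inj₂ m₁) end₀ end₃ other = end₃ (other (λ ()) m₁) (other (λ ()) m₁)

-- By the one class not hit by the three omitted vertices: if it is 0 or 1, a vertex of class 3 is
-- undominated; if it is 3, one of class 1 is; if it is 2, vertices of classes 1 and 3 have equal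
-- distances.
starPlusLike⇒≤η+2 : ∀ {n} {G : Graph n} (conn : Connected G) → StarPlusLike G → n ≤ η G conn + 2
starPlusLike⇒≤η+2 {G = G} conn (B , single₀ , single₂) = ≤η+ G conn 2 λ D (dom , loc) h →
  let f , κf-inj , f∉ = missed-classes D (blowup-twinSeparating conn B loc) h
      misses : ∀ {k} → ∃[ i ] κ (f i) ≡ k → Misses conn B D k
      misses (i , eq) = f i , eq , f∉ i
  in go D dom loc misses (im? (κ ∘ f)) (injective⇒misses-once κf-inj)
  where
  open Blowup B
  open Distance G conn
  open Graph G

  module _ (D : Subset _) (dom : Dominating G D) (loc : Locating G conn D)
           {h m : Fin 4 → Set} (misses : ∀ {k} → h k → Misses conn B D k) where

    end₃ : h (# 3) → h (# 2) → ⊥₀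
    end₃ h₃ h₂ = blocked conn B dom (misses h₃) λ l e →
      subst (λ l → Single l × Misses conn B D l) (sym (neighbour-of-3 l e)) (single₂ , misses h₂)

    end₁ : h (# 1) → h (# 0) → h (# 2) → ⊥₀
    end₁ h₁ h₀ h₂ = blocked conn B dom (misses h₁) λ l e →
      [ (λ { refl → single₀ , misses h₀ }) , (λ { refl → single₂ , misses h₂ }) ]′ (neighbour-of-1 l e)

    -- Class 0 has no vertex in D. The omitted vertices of classes 1 and 3 are at distance 1 from
    -- the centre and, through it, at distance 2 from all other vertices of D.
    tied : h (# 0) → h (# 1) → h (# 3) → ⊥₀
    tied h₀ h₁ h₃ with misses h₀ | misses h₁ | misses h₃
    ... | w , κw , w∉ | u , κu , u∉ | v , κv , v∉ =
      0≢1+n (cong toℕ (suc-injective (trans (sym κu) (trans (cong κ (loc u v same)) κv))))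
      where
      distance-via-centre : ∀ {y x} → y ~ rep (# 2) → x ~ rep (# 2) → x ≢ y → ¬ y ~ x →
                            distance G conn y x ≡ 2
      distance-via-centre p q x≢y y≁x = common⇒distance≡2 (≢-sym x≢y) y≁x p (~-sym q)
      centre~ : ∀ {y} k → κ y ≡ k → k ~[ P₄ ] (# 2) → y ~ rep (# 2)
      centre~ k refl p = κ⇒~ (subst (k ~[ P₄ ]_) (sym (κ-rep (# 2))) p)
      same : ∀ x → x ∈ D → distance G conn u x ≡ distance G conn v x
      same x x∈ with κ x in κx
      ... | zero = contradiction (subst (_∈ D) (trans (single₀ _ κx) (sym (single₀ _ κw))) x∈) w∉
      ... | suc (suc zero) = trans
              (~⇒distance≡1 (subst (u ~_) (sym (single₂ _ κx)) (centre~ (# 1) κu tt)))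
              (sym (~⇒distance≡1 (subst (v ~_) (sym (single₂ _ κx)) (centre~ (# 3) κv tt))))
      ... | suc zero = trans
              (distance-via-centre (centre~ (# 1) κu tt) (centre~ (# 1) κx tt) (λ { refl → u∉ x∈ })
                (λ p → subst₂ (_~[ P₄ ]_) κu κx (~⇒κ p)))
              (sym (distance-via-centre (centre~ (# 3) κv tt) (centre~ (# 1) κx tt) (λ { refl → v∉ x∈ })
                (λ p → subst₂ (_~[ P₄ ]_) κv κx (~⇒κ p))))
      ... | suc (suc (suc zero)) = trans
              (distance-via-centre (centre~ (# 1) κu tt) (centre~ (# 3) κx tt) (λ { refl → u∉ x∈ })
                (λ p → subst₂ (_~[ P₄ ]_) κu κx (~⇒κ p)))
              (sym (distance-via-centre (centre~ (# 3) κv tt) (centre~ (# 3) κx tt) (λ { refl → v∉ x∈ })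
                (λ p → subst₂ (_~[ P₄ ]_) κv κx (~⇒κ p))))

    go : (∀ k → h k ⊎ m k) → (∀ {k l} → k ≢ l → m k → h l) → ⊥₀
    go hit? other with hit? (# 0) | hit? (# 1) | hit? (# 2)
    ... | inj₂ m₀ | _       | _       = end₃ (other (λ ()) m₀) (other (λ ()) m₀)
    ... | _       | inj₂ m₁ | _       = end₃ (other (λ ()) m₁) (other (λ ()) m₁)
    ... | inj₁ h₀ | inj₁ h₁ | inj₂ m₂ = tied h₀ h₁ (other (λ ()) m₂)
    ... | inj₁ h₀ | inj₁ h₁ | inj₁ h₂ = end₁ h₁ h₀ h₂

-- If D misses a vertex of every class, then both singleton classes are missed, and
-- in the complement the remaining two classes form a clique.
blowup⇒complement-≤η+3 : ∀ {n} {G H : Graph n} (conn : Connected H) → G ⇌ H → (B : Blowup G) →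
  ∀ p q → p ≢ q → ¬ p ~[ P₄ ] q → (∀ k → k ≡ p ⊎ k ≡ q ⊎ Blowup.Single B k) →
  n ≤ η H conn + 3
blowup⇒complement-≤η+3 {G = G} {H} conn G⇌H B p q p≢q p≁q rest = ≤η+ H conn 3 λ D (dom , loc) h →
  let f , κf-inj , f∉ = missed-classes D (λ {u} {v} → twins D loc {u} {v}) h
      index = injective⇒onto κf-inj
      i , κp = index p
      j , κq = index q
      near : ∀ {i l} → l ≡ p ⊎ l ≡ q → κ (f i) ≡ l → ∀ x → x ∈ D → distance H conn (f i) x ≡ 1
      near l∈ eq x x∈ = ~⇒distance≡1 (co⁺ (λ { refl → f∉ _ x∈ }) λ e →
        independent l∈ (remaining D f f∉ index x x∈) (subst (_~[ P₄ ] κ x) eq (~⇒κ e)))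
  -- The omitted vertices of classes p and q are both at distance 1 from all of D, hence equal.
  in p≢q (trans (sym κp) (trans
       (cong κ (loc (f i) (f j) λ x x∈ → trans (near (inj₁ refl) κp x x∈) (sym (near (inj₂ refl) κq x x∈)))) κq))
  where
  open Blowup B
  open Distance H conn
  open _⇌_ G⇌H

  independent : ∀ {k l} → k ≡ p ⊎ k ≡ q → l ≡ p ⊎ l ≡ q → ¬ k ~[ P₄ ] l
  independent (inj₁ refl) (inj₁ refl) = Graph.~-irrefl P₄ {p}
  independent (inj₁ refl) (inj₂ refl) = p≁q
  independent (inj₂ refl) (inj₁ refl) = p≁q ∘ ~-sym[ P₄ ] {q} {p}
  independent (inj₂ refl) (inj₂ refl) = Graph.~-irrefl P₄ {q}

  remaining : ∀ D (f : Fin 4 → Fin _) → (∀ i → f i ∉ D) → (∀ k → ∃[ i ] κ (f i) ≡ k) →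
              ∀ x → x ∈ D → κ x ≡ p ⊎ κ x ≡ q
  remaining D f f∉ index x x∈ with rest (κ x)
  ... | inj₁ eq = inj₁ eq
  ... | inj₂ (inj₁ eq) = inj₂ eq
  ... | inj₂ (inj₂ single) = let i , eq = index (κ x) in
          contradiction (subst (_∈ D) (trans (single _ refl) (sym (single _ eq))) x∈) (f∉ i)

  -- In the complement the vertices of a class are true twins.
  twins : ∀ D → Locating H conn D → TwinSeparating κ D
  twins D loc {u} {v} u∉ v∉ eq = loc u v λ x x∈ → twin-distance
    (λ w w≢u w≢v → mk⇔ (half eq w≢v) (half (sym eq) w≢u))
    (λ { refl → u∉ x∈ }) (λ { refl → v∉ x∈ })
    where
    half : ∀ {u v w} → κ u ≡ κ v → w ≢ v → u ~[ H ] w → v ~[ H ] w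
    half {w = w} eq w≢v e = co⁺ (≢-sym w≢v) λ e′ → co⁻ e (κ⇒~ (subst (_~[ P₄ ] κ w) (sym eq) (~⇒κ e′)))

doubleStarLike⇒complement-≤η+3 : ∀ {n} {G H : Graph n} (conn : Connected H) → G ⇌ H →
                                 DoubleStarLike G → n ≤ η H conn + 3
doubleStarLike⇒complement-≤η+3 conn G⇌H (B , single₁ , single₂) =
  blowup⇒complement-≤η+3 conn G⇌H B (# 0) (# 3) (λ ()) (λ ()) λ
    { zero                   → inj₁ refl
    ; (suc zero)             → inj₂ (inj₂ single₁)
    ; (suc (suc zero))       → inj₂ (inj₂ single₂)
    ; (suc (suc (suc zero))) → inj₂ (inj₁ refl) }

starPlusLike⇒complement-≤η+3 : ∀ {n} {G H : Graph n} (conn : Connected H) → G ⇌ H →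
                               StarPlusLike G → n ≤ η H conn + 3
starPlusLike⇒complement-≤η+3 conn G⇌H (B , single₀ , single₂) =
  blowup⇒complement-≤η+3 conn G⇌H B (# 1) (# 3) (λ ()) (λ ()) λ
    { zero                   → inj₂ (inj₂ single₀)
    ; (suc zero)             → inj₁ refl
    ; (suc (suc zero))       → inj₂ (inj₂ single₂)
    ; (suc (suc (suc zero))) → inj₂ (inj₁ refl) }

-- Double stars and the graphs K^s_{1,r} as blow-ups of P₄

-- Both families list their vertices alike: two special vertices, then p leaves of one kind and q of
-- another. The map c sends these four slots to the vertices of P₄.
module Layout (c : Fin 4 → Fin 4) (c-inj : Injective _≡_ _≡_ c) (p q : ℕ) where

  leaf₁ : Fin p → Fin (2 + (p + q))
  leaf₁ i = 2 ↑ʳ (i ↑ˡ q)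

  leaf₂ : Fin q → Fin (2 + (p + q))
  leaf₂ j = 2 ↑ʳ (p ↑ʳ j)

  slot : Fin (2 + (p + q)) → Fin 4
  slot zero          = # 0
  slot (suc zero)    = # 1
  slot (suc (suc i)) = [ const (# 2) , const (# 3) ]′ (splitAt p i)

  slot-leaf₁ : ∀ i → slot (leaf₁ i) ≡ # 2
  slot-leaf₁ i rewrite splitAt-↑ˡ p i q = refl

  slot-leaf₂ : ∀ j → slot (leaf₂ j) ≡ # 3
  slot-leaf₂ j rewrite splitAt-↑ʳ p q j = refl

  data View : Fin (2 + (p + q)) → Fin 4 → Set where
    centre₀ : View zero (# 0)
    centre₁ : View (suc zero) (# 1)
    isLeaf₁ : ∀ i → View (leaf₁ i) (# 2)
    isLeaf₂ : ∀ j → View (leaf₂ j) (# 3)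

  view : ∀ u → View u (slot u)
  view zero          = centre₀
  view (suc zero)    = centre₁
  view (suc (suc i)) with splitAt p i in eq
  ... | inj₁ j = subst (λ i → View (2 ↑ʳ i) (# 2)) (splitAt⁻¹-↑ˡ eq) (isLeaf₁ j)
  ... | inj₂ j = subst (λ i → View (2 ↑ʳ i) (# 3)) (splitAt⁻¹-↑ʳ eq) (isLeaf₂ j)

  c-onto : ∀ k → ∃[ s ] c s ≡ k
  c-onto = injective⇒onto c-inj

  module _ {H : Graph (2 + (p + q))}
           (~⇒c : ∀ {u v} → u ~[ H ] v → c (slot u) ~[ P₄ ] c (slot v))
           (c⇒~ : ∀ {u v} → c (slot u) ~[ P₄ ] c (slot v) → u ~[ H ] v) where

    -- The arguments supply representatives of the two leaf classes.
    layout⇒blowup : Fin p → Fin q →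
                    Σ (Blowup H) λ B → Blowup.Single B (c (# 0)) × Blowup.Single B (c (# 1))
    layout⇒blowup i j = record
        { κ = c ∘ slot ; rep = at ∘ c⁻¹
        ; κ-rep = λ k → trans (cong c (slot-at (c⁻¹ k))) (proj₂ (c-onto k))
        ; ~⇒κ = ~⇒c ; κ⇒~ = c⇒~ }
      , (λ v eq → trans (centre v (# 0) (inj₁ refl) (c-inj eq)) (cong at (sym (c⁻¹-c (# 0)))))
      , (λ v eq → trans (centre v (# 1) (inj₂ refl) (c-inj eq)) (cong at (sym (c⁻¹-c (# 1)))))
      where
      c⁻¹ : Fin 4 → Fin 4
      c⁻¹ = proj₁ ∘ c-onto
      c⁻¹-c : ∀ s → c⁻¹ (c s) ≡ s
      c⁻¹-c s = c-inj (proj₂ (c-onto (c s)))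

      at : Fin 4 → Fin (2 + (p + q))
      at = lookup (zero ∷ suc zero ∷ leaf₁ i ∷ leaf₂ j ∷ [])

      slot-at : ∀ s → slot (at s) ≡ s
      slot-at zero                   = refl
      slot-at (suc zero)             = refl
      slot-at (suc (suc zero))       = slot-leaf₁ i
      slot-at (suc (suc (suc zero))) = slot-leaf₂ j

      centre : ∀ v s → s ≡ # 0 ⊎ s ≡ # 1 → slot v ≡ s → v ≡ at s
      centre v s s∈ eq with slot v | view v
      centre _ _ _         refl | _ | centre₀ = refl
      centre _ _ _         refl | _ | centre₁ = refl
      centre _ _ (inj₁ ()) refl | _ | isLeaf₁ _
      centre _ _ (inj₂ ()) refl | _ | isLeaf₁ _
      centre _ _ (inj₁ ()) refl | _ | isLeaf₂ _
      centre _ _ (inj₂ ()) refl | _ | isLeaf₂ _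

    -- A blow-up is determined by its class sizes: enumerations of the two remaining classes place
    -- the leaves.
    blowup⇒≅ : ∀ {n} {G : Graph n} (B : Blowup G) → let open Blowup B in
               Single (c (# 0)) → Single (c (# 1)) →
               p ≡ ∣ ⟪ (λ v → κ v ≟ c (# 2)) ⟫ ∣ → q ≡ ∣ ⟪ (λ v → κ v ≟ c (# 3)) ⟫ ∣ → G ≅ H
    blowup⇒≅ {n} {G} B single₀ single₁ refl refl = ≅-sym (surjective⇒≅ {H = H} {G = G} emb onto)
      where
      open Blowup B

      class? : ∀ k → Decidable (λ v → κ v ≡ k)
      class? k v = κ v ≟ k

      f₁ = enumerate ⟪ class? (c (# 2)) ⟫
      f₂ = enumerate ⟪ class? (c (# 3)) ⟫

      place : Fin p ⊎ Fin q → Fin n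
      place = [ proj₁ f₁ , proj₁ f₂ ]′

      κ-place : ∀ x → κ (place x) ≡ c ([ const (# 2) , const (# 3) ]′ x)
      κ-place (inj₁ i) = ∈⟪⟫⁻ (class? _) (proj₁ (proj₂ (proj₂ f₁)) i)
      κ-place (inj₂ j) = ∈⟪⟫⁻ (class? _) (proj₁ (proj₂ (proj₂ f₂)) j)

      place-inj : Injective _≡_ _≡_ place
      place-inj {inj₁ i} {inj₁ j} eq = cong inj₁ (proj₁ (proj₂ f₁) eq)
      place-inj {inj₂ i} {inj₂ j} eq = cong inj₂ (proj₁ (proj₂ f₂) eq)
      place-inj {inj₁ i} {inj₂ j} eq = contradiction
        (c-inj (trans (sym (κ-place (inj₁ i))) (trans (cong κ eq) (κ-place (inj₂ j))))) λ ()
      place-inj {inj₂ i} {inj₁ j} eq = contradiction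
        (c-inj (trans (sym (κ-place (inj₂ i))) (trans (cong κ eq) (κ-place (inj₁ j))))) λ ()

      leaves : Fin (p + q) → Fin n
      leaves = place ∘ splitAt p

      leaves-inj : Injective _≡_ _≡_ leaves
      leaves-inj {i} {j} eq = trans (sym (join-splitAt p q i))
        (trans (cong (join p q) (place-inj {splitAt p i} {splitAt p j} eq)) (join-splitAt p q j))

      e : Fin (2 + (p + q)) → Fin n
      e = rep (c (# 0)) Functional.∷ rep (c (# 1)) Functional.∷ leaves

      κ-e : ∀ u → κ (e u) ≡ c (slot u)
      κ-e zero          = κ-rep (c (# 0))
      κ-e (suc zero)    = κ-rep (c (# 1))
      κ-e (suc (suc i)) = κ-place (splitAt p i)

      separate : ∀ {u v} → e u ≡ e v → slot u ≡ slot v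
      separate {u} {v} eq = c-inj (trans (sym (κ-e u)) (trans (cong κ eq) (κ-e v)))

      leaf≢0 : ∀ x → # 0 ≢ [ const (# 2) , const (# 3) ]′ x
      leaf≢0 (inj₁ _) ()
      leaf≢0 (inj₂ _) ()

      leaf≢1 : ∀ x → # 1 ≢ [ const (# 2) , const (# 3) ]′ x
      leaf≢1 (inj₁ _) ()
      leaf≢1 (inj₂ _) ()

      e-inj : Injective _≡_ _≡_ e
      e-inj = ∷-injective
        (λ { zero eq → contradiction (separate {zero} {suc zero} eq) λ ()
           ; (suc i) eq → leaf≢0 (splitAt p i) (separate {zero} {suc (suc i)} eq) })
        (∷-injective (λ i eq → leaf≢1 (splitAt p i) (separate {suc zero} {suc (suc i)} eq)) leaves-inj)

      emb : Embedding H G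
      emb = record
        { map = e ; injective = e-inj
        ; preserve = λ {u} {v} p → κ⇒~ (subst₂ (_~[ P₄ ]_) (sym (κ-e u)) (sym (κ-e v)) (~⇒c p))
        ; reflect = λ {u} {v} p → c⇒~ (subst₂ (_~[ P₄ ]_) (κ-e u) (κ-e v) (~⇒κ p)) }

      onto : ∀ v → ∃[ u ] e u ≡ v
      onto v with c-onto (κ v)
      ... | zero , eq = zero , sym (single₀ v (sym eq))
      ... | suc zero , eq = suc zero , sym (single₁ v (sym eq))
      ... | suc (suc zero) , eq =
              let i , eq′ = proj₂ (proj₂ (proj₂ f₁)) v (∈⟪⟫⁺ (class? _) (sym eq)) in
              leaf₁ i , trans (cong place (splitAt-↑ˡ p i q)) eq′
      ... | suc (suc (suc zero)) , eq =
              let j , eq′ = proj₂ (proj₂ (proj₂ f₂)) v (∈⟪⟫⁺ (class? _) (sym eq)) in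
              leaf₂ j , trans (cong place (splitAt-↑ʳ p q j)) eq′

-- The centres become the inner vertices 1 and 2, their leaves the ends 0 and 3.
doubleStarClass : Fin 4 → Fin 4
doubleStarClass = lookup (# 1 ∷ # 2 ∷ # 0 ∷ # 3 ∷ [])

-- The centre becomes 2, the added vertex 0, the leaves joined to both 1, and the other leaves 3.
starPlusClass : Fin 4 → Fin 4
starPlusClass = lookup (# 2 ∷ # 0 ∷ # 1 ∷ # 3 ∷ [])

Arc : Fin 4 → Fin 4 → Fin 4 → Fin 4 → Set
Arc s t s′ t′ = s ≡ s′ × t ≡ t′

arc? : ∀ s t s′ t′ → Dec (Arc s t s′ t′)
arc? s t s′ t′ = (s ≟ s′) ×-dec (t ≟ t′)

opaque

  doubleStarClass-injective : ∀ s t → doubleStarClass s ≡ doubleStarClass t → s ≡ t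
  doubleStarClass-injective = from-yes (all? λ s → all? λ t →
    (doubleStarClass s ≟ doubleStarClass t) →-dec (s ≟ t))

  starPlusClass-injective : ∀ s t → starPlusClass s ≡ starPlusClass t → s ≡ t
  starPlusClass-injective = from-yes (all? λ s → all? λ t →
    (starPlusClass s ≟ starPlusClass t) →-dec (s ≟ t))

-- Edges between slots, oriented as in the edge list of `doubleStar`.
DoubleStarArc : Fin 4 → Fin 4 → Set
DoubleStarArc s t = Arc s t (# 0) (# 1) ⊎ Arc s t (# 0) (# 2) ⊎ Arc s t (# 1) (# 3)

StarPlusArc : Fin 4 → Fin 4 → Set
StarPlusArc s t = Arc s t (# 0) (# 2) ⊎ Arc s t (# 0) (# 3) ⊎ Arc s t (# 1) (# 2)

doubleStarArc? : ∀ s t → Dec (DoubleStarArc s t)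
doubleStarArc? s t = arc? s t (# 0) (# 1) ⊎-dec arc? s t (# 0) (# 2) ⊎-dec arc? s t (# 1) (# 3)

starPlusArc? : ∀ s t → Dec (StarPlusArc s t)
starPlusArc? s t = arc? s t (# 0) (# 2) ⊎-dec arc? s t (# 0) (# 3) ⊎-dec arc? s t (# 1) (# 2)

opaque

  doubleStar-arcs : ∀ s t → doubleStarClass s ~[ P₄ ] doubleStarClass t → DoubleStarArc s t ⊎ DoubleStarArc t s
  doubleStar-arcs = from-yes (all? λ s → all? λ t → ~?[ P₄ ] (doubleStarClass s) (doubleStarClass t) →-dec
    (doubleStarArc? s t ⊎-dec doubleStarArc? t s))

  starPlus-arcs : ∀ s t → starPlusClass s ~[ P₄ ] starPlusClass t → StarPlusArc s t ⊎ StarPlusArc t s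
  starPlus-arcs = from-yes (all? λ s → all? λ t → ~?[ P₄ ] (starPlusClass s) (starPlusClass t) →-dec
    (starPlusArc? s t ⊎-dec starPlusArc? t s))

module DoubleStar (r s : ℕ) where
  open Layout doubleStarClass (λ {s} {t} → doubleStarClass-injective s t) r s public

  private
    c = doubleStarClass

    Edges = List (Fin (2 + (r + s)) × Fin (2 + (r + s)))

    stars₀ stars₁ edges : Edges
    stars₀ = List.map (λ (i : Fin r) → zero , leaf₁ i) (allFin r)
    stars₁ = List.map (λ (j : Fin s) → suc zero , leaf₂ j) (allFin s)
    edges = (zero , suc zero) ∷ stars₀ List.++ stars₁

    edge⇒c : ∀ {u v} → (u , v) ∈ˡ edges → c (slot u) ~[ P₄ ] c (slot v)
    edge⇒c (here refl) = tt
    edge⇒c (there e) with ∈-++⁻ stars₀ e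
    ... | inj₁ e₀ with ∈-map⁻ _ e₀
    ...   | i , _ , refl = subst (λ t → c (# 0) ~[ P₄ ] c t) (sym (slot-leaf₁ i)) tt
    edge⇒c (there e) | inj₂ e₁ with ∈-map⁻ _ e₁
    ...   | j , _ , refl = subst (λ t → c (# 1) ~[ P₄ ] c t) (sym (slot-leaf₂ j)) tt

    arc⇒edge : ∀ {u v s t} → View u s → View v t → DoubleStarArc s t → (u , v) ∈ˡ edges
    arc⇒edge centre₀ centre₁   (inj₁ _) = here refl
    arc⇒edge centre₀ (isLeaf₁ i) (inj₂ (inj₁ _)) = there (∈-++⁺ˡ (∈-map⁺ _ (∈-allFin i)))
    arc⇒edge centre₁ (isLeaf₂ j) (inj₂ (inj₂ _)) = there (∈-++⁺ʳ stars₀ (∈-map⁺ _ (∈-allFin j)))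

  ~⇒class : ∀ {u v} → u ~[ doubleStar r s ] v → c (slot u) ~[ P₄ ] c (slot v)
  ~⇒class (_ , inj₁ e) = edge⇒c e
  ~⇒class {u} {v} (_ , inj₂ e) = ~-sym[ P₄ ] {c (slot v)} {c (slot u)} (edge⇒c e)

  class⇒~ : ∀ {u v} → c (slot u) ~[ P₄ ] c (slot v) → u ~[ doubleStar r s ] v
  class⇒~ {u} {v} p = (λ { refl → Graph.~-irrefl P₄ {c (slot u)} p })
    , Sum.map (arc⇒edge (view u) (view v)) (arc⇒edge (view v) (view u)) (doubleStar-arcs (slot u) (slot v) p)

module StarPlus (p q : ℕ) where
  open Layout starPlusClass (λ {s} {t} → starPlusClass-injective s t) p q public

  private
    c = starPlusClass

    Edges = List (Fin (2 + (p + q)) × Fin (2 + (p + q)))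

    star₀ star₁ edges : Edges
    star₀ = List.map (λ (i : Fin (p + q)) → zero , 2 ↑ʳ i) (allFin (p + q))
    star₁ = List.map (λ (i : Fin (p + q)) → suc zero , 2 ↑ʳ i)
                     (filter (λ i → toℕ i <? p) (allFin (p + q)))
    edges = star₀ List.++ star₁

    edge⇒c : ∀ {u v} → (u , v) ∈ˡ edges → c (slot u) ~[ P₄ ] c (slot v)
    edge⇒c e with ∈-++⁻ star₀ e
    ... | inj₁ e₀ with ∈-map⁻ _ e₀
    ...   | i , _ , refl with splitAt p i
    ...     | inj₁ _ = tt
    ...     | inj₂ _ = tt
    edge⇒c e | inj₂ e₁ with ∈-map⁻ _ e₁
    ...   | i , i∈ , refl
            rewrite splitAt-< p i (proj₂ (∈-filter⁻ (λ i → toℕ i <? p) {xs = allFin (p + q)} i∈)) = tt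

    arc⇒edge : ∀ {u v s t} → View u s → View v t → StarPlusArc s t → (u , v) ∈ˡ edges
    arc⇒edge centre₀ (isLeaf₁ i) (inj₁ _) = ∈-++⁺ˡ (∈-map⁺ _ (∈-allFin (i ↑ˡ q)))
    arc⇒edge centre₀ (isLeaf₂ j) (inj₂ (inj₁ _)) = ∈-++⁺ˡ (∈-map⁺ _ (∈-allFin (p ↑ʳ j)))
    arc⇒edge centre₁ (isLeaf₁ i) (inj₂ (inj₂ _)) = ∈-++⁺ʳ star₀ (∈-map⁺ _
      (∈-filter⁺ (λ i → toℕ i <? p) (∈-allFin (i ↑ˡ q)) (subst (_< p) (sym (toℕ-↑ˡ i q)) (toℕ<n i))))

  ~⇒class : ∀ {u v} → u ~[ starPlus (p + q) p ] v → c (slot u) ~[ P₄ ] c (slot v)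
  ~⇒class (_ , inj₁ e) = edge⇒c e
  ~⇒class {u} {v} (_ , inj₂ e) = ~-sym[ P₄ ] {c (slot v)} {c (slot u)} (edge⇒c e)

  class⇒~ : ∀ {u v} → c (slot u) ~[ P₄ ] c (slot v) → u ~[ starPlus (p + q) p ] v
  class⇒~ {u} {v} p = (λ { refl → Graph.~-irrefl P₄ {c (slot u)} p })
    , Sum.map (arc⇒edge (view u) (view v)) (arc⇒edge (view v) (view u)) (starPlus-arcs (slot u) (slot v) p)

blowup-≅ : ∀ {m n} {G : Graph m} {H : Graph n} → G ≅ H → (B : Blowup H) →
           Σ (Blowup G) λ B′ → ∀ k → Blowup.Single B k → Blowup.Single B′ k
blowup-≅ G≅H B = record
    { κ = κ ∘ to ; rep = from ∘ rep
    ; κ-rep = λ k → trans (cong κ (Inverse.strictlyInverseˡ bijection (rep k))) (κ-rep k)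
    ; ~⇒κ = λ {u} {v} → ~⇒κ ∘ Equivalence.to (preserves u v)
    ; κ⇒~ = λ {u} {v} → Equivalence.from (preserves u v) ∘ κ⇒~ }
  , λ k single v eq → trans (sym (Inverse.strictlyInverseʳ bijection v)) (cong from (single (to v) eq))
  where
  open Blowup B
  open _≅_ G≅H

1≤class : ∀ {n} {G : Graph n} (B : Blowup G) k → 1 ≤ ∣ ⟪ (λ v → Blowup.κ B v ≟ k) ⟫ ∣
1≤class B k = within⇒≤∣∣ ⟪ κ≟k ⟫ {f = λ (_ : Fin 1) → rep k} (λ { {zero} {zero} _ → refl })
                                 (λ _ → ∈⟪⟫⁺ κ≟k (κ-rep k))
  where
  open Blowup B
  κ≟k = λ v → κ v ≟ k

2≤class : ∀ {n} {G : Graph n} (B : Blowup G) → let open Blowup B in ∀ {k v} → κ v ≡ k → v ≢ rep k →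
          2 ≤ ∣ ⟪ (λ v → κ v ≟ k) ⟫ ∣
2≤class B {k} {v} eq v≢ = within⇒≤∣∣ ⟪ κ≟k ⟫ {f = v Functional.∷ rep k Functional.∷ λ ()}
  (∷-injective (λ { zero → v≢ ; (suc ()) }) (∷-injective (λ ()) λ { {()} }))
  λ { zero → ∈⟪⟫⁺ κ≟k eq ; (suc zero) → ∈⟪⟫⁺ κ≟k (κ-rep k) }
  where
  open Blowup B
  κ≟k = λ v → κ v ≟ k

doubleStarLike⇒≅ : ∀ {n} {G : Graph n} → DoubleStarLike G →
                   ∃[ r ] ∃[ s ] (1 ≤ r × 1 ≤ s × G ≅ doubleStar r s)
doubleStarLike⇒≅ (B , single₁ , single₂) = _ , _ , 1≤class B (# 0) , 1≤class B (# 3) ,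
  DoubleStar.blowup⇒≅ _ _ (DoubleStar.~⇒class _ _) (DoubleStar.class⇒~ _ _) B single₁ single₂ refl refl

≅⇒doubleStarLike : ∀ {n} {G : Graph n} {r s} → 1 ≤ r → 1 ≤ s → G ≅ doubleStar r s → DoubleStarLike G
≅⇒doubleStarLike {r = suc r} {suc s} _ _ iso =
  let B , single₁ , single₂ = DoubleStar.layout⇒blowup (suc r) (suc s)
                                (DoubleStar.~⇒class _ _) (DoubleStar.class⇒~ _ _) zero zero
      B′ , single = blowup-≅ iso B
  in B′ , single _ single₁ , single _ single₂

starPlusLike⇒≅ : ∀ {n} {G : Graph n} ((B , _) : StarPlusLike G) →
                 ∃[ v ] (Blowup.κ B v ≡ # 1 × v ≢ Blowup.rep B (# 1)) →
                 ∃[ r ] ∃[ s ] (2 ≤ s × s ≤ r ∸ 1 × G ≅ starPlus r s)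
starPlusLike⇒≅ {G = G} (B , single₀ , single₂) (v , κv , v≢) =
  -- Here s is the size of class 1, which contains v and its representative, and r - s is the size
  -- of class 3, at least 1.
  _ , _ , 2≤class B κv v≢ , bound _ (1≤class B (# 3)) ,
  StarPlus.blowup⇒≅ _ _ (StarPlus.~⇒class _ _) (StarPlus.class⇒~ _ _) B single₂ single₀ refl refl
  where
  bound : ∀ p {q} → 1 ≤ q → p ≤ p + q ∸ 1
  bound p {suc q} _ = subst (λ m → p ≤ m ∸ 1) (sym (+-suc p q)) (m≤m+n p q)

≅⇒starPlusLike : ∀ {n} {G : Graph n} {r s} → 2 ≤ s → s ≤ r ∸ 1 → G ≅ starPlus r s → StarPlusLike G
≅⇒starPlusLike {G = G} {r = suc r} {s = suc s} _ s≤r iso =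
  let B , single₂ , single₀ = StarPlus.layout⇒blowup (suc s) (suc (r ∸ suc s))
                                (StarPlus.~⇒class _ _) (StarPlus.class⇒~ _ _) zero zero
      B′ , single = blowup-≅ (subst (λ r → G ≅ starPlus r (suc s)) split iso) B
  in B′ , single _ single₀ , single _ single₂
  where
  -- The second block holds the leaves not joined to the added vertex; the bound on s makes its size
  -- a successor.
  split : suc r ≡ suc s + suc (r ∸ suc s)
  split = sym (trans (+-suc (suc s) (r ∸ suc s)) (cong suc (m+[n∸m]≡n s≤r)))

-- Pairs of vertices that form a metric-locating-dominating set

module _ {n} (G : Graph n) where
  open Graph G

  Common : Fin n → Fin n → Set
  Common u z = ∃[ w ] (u ~ w × w ~ z)

  common? : ∀ u z → Dec (Common u z)
  common? u z = any? λ w → (u ~? w) ×-dec (w ~? z)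

  -- For u and v other than z: both distances to z are 1 or both are 2, witnessed by data that
  -- persist in larger graphs.
  Tied : Fin n → Fin n → Fin n → Set
  Tied u v z = (u ~ z × v ~ z) ⊎ (¬ u ~ z × ¬ v ~ z × Common u z × Common v z)

  tied? : ∀ u v z → Dec (Tied u v z)
  tied? u v z = ((u ~? z) ×-dec (v ~? z))
    ⊎-dec (¬? (u ~? z) ×-dec ¬? (v ~? z) ×-dec common? u z ×-dec common? v z)

  -- For u and v other than z: exactly one distance to z is 1, or one is 2 while the other vertex
  -- has no common neighbour with z.
  Split : Fin n → Fin n → Fin n → Set
  Split u v z = Differ G u v z
    ⊎ (¬ u ~ z × Common u z × ¬ Common v z) ⊎ (¬ v ~ z × ¬ Common u z × Common v z)

  split? : ∀ u v z → Dec (Split u v z)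
  split? u v z = (((u ~? z) ×-dec ¬? (v ~? z)) ⊎-dec (¬? (u ~? z) ×-dec (v ~? z)))
    ⊎-dec (¬? (u ~? z) ×-dec common? u z ×-dec ¬? (common? v z))
    ⊎-dec (¬? (v ~? z) ×-dec ¬? (common? u z) ×-dec common? v z)

  DominatingPair : Fin n → Fin n → Set
  DominatingPair x y = ∀ v → v ≢ x → v ≢ y → v ~ x ⊎ v ~ y

  dominatingPair? : ∀ x y → Dec (DominatingPair x y)
  dominatingPair? x y = all? λ v → ¬? (v ≟ x) →-dec ¬? (v ≟ y) →-dec ((v ~? x) ⊎-dec (v ~? y))

  ForOutsiders : Fin n → Fin n → (Fin n → Fin n → Set) → Set
  ForOutsiders x y R = ∀ u → u ≢ x → u ≢ y → ∀ v → v ≢ x → v ≢ y → u ≢ v → R u v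

  forOutsiders? : ∀ x y {R} → (∀ u v → Dec (R u v)) → Dec (ForOutsiders x y R)
  forOutsiders? x y R? = all? λ u → ¬? (u ≟ x) →-dec ¬? (u ≟ y) →-dec
                         all? λ v → ¬? (v ≟ x) →-dec ¬? (v ≟ y) →-dec ¬? (u ≟ v) →-dec R? u v

  -- Necessary for {x , y} to be metric-locating-dominating, and inherited by induced
  -- subgraphs that contain x and y.
  Weak : Fin n → Fin n → Set
  Weak x y = DominatingPair x y × ForOutsiders x y λ u v → ¬ (Tied u v x × Tied u v y)

  weak? : ∀ x y → Dec (Weak x y)
  weak? x y = dominatingPair? x y ×-dec forOutsiders? x y λ u v → ¬? (tied? u v x ×-dec tied? u v y)

  -- Sufficient for {x , y} to be metric-locating-dominating.
  Strong : Fin n → Fin n → Set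
  Strong x y = DominatingPair x y × ForOutsiders x y λ u v → Split u v x ⊎ Split u v y

  strong? : ∀ x y → Dec (Strong x y)
  strong? x y = dominatingPair? x y ×-dec forOutsiders? x y λ u v → split? u v x ⊎-dec split? u v y

weak-swap : ∀ {n} {G : Graph n} {x y} → Weak G x y → Weak G y x
weak-swap (dom , sep) =
    (λ v v≢y v≢x → swap (dom v v≢x v≢y))
  , (λ u u≢y u≢x v v≢y v≢x u≢v (t , t′) → sep u u≢x u≢y v v≢x v≢y u≢v (t′ , t))

module _ {k n} {H : Graph k} {G : Graph n} (e : Embedding H G) where

  tied-embedding : ∀ {u v z} → Tied H u v z → Tied G (map e u) (map e v) (map e z)
  tied-embedding = Sum.map
    (λ (p , q) → preserve e p , preserve e q)
    (λ (p , q , c , c′) → p ∘ reflect e , q ∘ reflect e , common c , common c′)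
    where
    common : ∀ {u z} → Common H u z → Common G (map e u) (map e z)
    common (w , p , q) = map e w , preserve e p , preserve e q

  weak-embedding : ∀ {x y} → Weak G (map e x) (map e y) → Weak H x y
  weak-embedding (dom , sep) =
      (λ v v≢x v≢y → Sum.map (reflect e) (reflect e)
         (dom (map e v) (v≢x ∘ injective e) (v≢y ∘ injective e)))
    , (λ u u≢x u≢y v v≢x v≢y u≢v (t , t′) →
         sep (map e u) (u≢x ∘ injective e) (u≢y ∘ injective e)
             (map e v) (v≢x ∘ injective e) (v≢y ∘ injective e) (u≢v ∘ injective e)
             (tied-embedding t , tied-embedding t′))

strong-≅ : ∀ {k n} {H : Graph k} {G : Graph n} (G≅H : G ≅ H) {x y : Fin k} → Strong H x y →
           Strong G (_≅_.from G≅H x) (_≅_.from G≅H y)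
strong-≅ {H = H} {G} G≅H {x} {y} (dom , sep) =
    (λ v v≢x v≢y → Sum.map (back x) (back y) (dom (to v) (away v≢x) (away v≢y)))
  , (λ u u≢x u≢y v v≢x v≢y u≢v → Sum.map (split x) (split y)
       (sep (to u) (away u≢x) (away u≢y) (to v) (away v≢x) (away v≢y) (u≢v ∘ injective e)))
  where
  open _≅_ G≅H
  e = ≅⇒embedding G≅H

  to-from : ∀ z → to (from z) ≡ z
  to-from = Inverse.strictlyInverseˡ bijection

  away : ∀ {v z} → v ≢ from z → to v ≢ z
  away v≢ refl = v≢ (sym (Inverse.strictlyInverseʳ bijection _))

  back : ∀ {u} z → to u ~[ H ] z → u ~[ G ] from z
  back z p = reflect e (subst (to _ ~[ H ]_) (sym (to-from z)) p)

  forth : ∀ {u} z → u ~[ G ] from z → to u ~[ H ] z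
  forth z p = subst (to _ ~[ H ]_) (to-from z) (preserve e p)

  common-back : ∀ {u} z → Common H (to u) z → Common G u (from z)
  common-back {u} z (w , p , q) = from w , back w p
    , back z (subst (_~[ H ] z) (sym (to-from w)) q)

  common-forth : ∀ {u} z → Common G u (from z) → Common H (to u) z
  common-forth z (w , p , q) = to w , preserve e p , forth z q

  split : ∀ {u v} z → Split H (to u) (to v) z → Split G u v (from z)
  split z = Sum.map
    (Sum.map (λ (p , q) → back z p , q ∘ forth z) (λ (p , q) → p ∘ forth z , back z q))
    (Sum.map (λ (p , c , c′) → p ∘ forth z , common-back z c , c′ ∘ common-forth z)
             (λ (p , c , c′) → p ∘ forth z , c ∘ common-forth z , common-back z c′))

module _ {n} {G : Graph n} (conn : Connected G) where
  open Graph G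
  open Distance G conn

  private
    d : Fin n → Fin n → ℕ
    d = distance G conn

  η≡2⇒weak : η G conn ≡ 2 → ∃[ x ] ∃[ y ] (x ≢ y × Weak G x y)
  η≡2⇒weak η≡2 with η-attained
  ... | D , (dom , loc) , size with ∣ D ∣ | trans size η≡2 | enumerate D
  ...   | _ | refl | f , f-inj , f∈ , f-onto =
          f (# 0) , f (# 1) , (λ eq → contradiction (f-inj eq) λ ()) , dominating , separating
    where
    pair : ∀ {v} → v ∈ D → v ≡ f (# 0) ⊎ v ≡ f (# 1)
    pair {v} v∈ with f-onto v v∈
    ... | zero     , eq = inj₁ (sym eq)
    ... | suc zero , eq = inj₂ (sym eq)

    dominating : DominatingPair G (f (# 0)) (f (# 1))
    dominating v v≢x v≢y with dom v (λ v∈ → [ v≢x , v≢y ]′ (pair v∈))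
    ... | z , z∈ , p = Sum.map (λ { refl → p }) (λ { refl → p }) (pair z∈)

    tied⇒≡ : ∀ {u v z} → u ≢ z → v ≢ z → Tied G u v z → d u z ≡ d v z
    tied⇒≡ u≢z v≢z (inj₁ (p , q)) = trans (~⇒distance≡1 p) (sym (~⇒distance≡1 q))
    tied⇒≡ u≢z v≢z (inj₂ (p , q , (_ , c₁ , c₂) , (_ , c₃ , c₄))) =
      trans (common⇒distance≡2 u≢z p c₁ c₂) (sym (common⇒distance≡2 v≢z q c₃ c₄))

    separating : ForOutsiders G (f (# 0)) (f (# 1)) λ u v → ¬ (Tied G u v (f (# 0)) × Tied G u v (f (# 1)))
    separating u u≢x u≢y v v≢x v≢y u≢v (t , t′) = u≢v (loc u v λ z z∈ → [
      (λ { refl → tied⇒≡ u≢x v≢x t }) , (λ { refl → tied⇒≡ u≢y v≢y t′ }) ]′ (pair z∈))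

  strong⇒η≤2 : ∀ {x y} → Strong G x y → η G conn ≤ 2
  strong⇒η≤2 {x} {y} (dom , sep) = ≤-trans (η≤ (dominating , locating))
    (covered⇒∣∣≤ D (lookup (x ∷ y ∷ [])) λ v v∈ →
      [ (λ eq → # 0 , sym eq) , (λ eq → # 1 , sym eq) ]′ (∈⟪⟫⁻ pair? v∈))
    where
    pair? : Decidable (λ v → v ≡ x ⊎ v ≡ y)
    pair? v = (v ≟ x) ⊎-dec (v ≟ y)

    D : Subset n
    D = ⟪ pair? ⟫

    dominating : Dominating G D
    dominating v v∉ with dom v (λ eq → v∉ (∈⟪⟫⁺ pair? (inj₁ eq))) (λ eq → v∉ (∈⟪⟫⁺ pair? (inj₂ eq)))
    ... | inj₁ p = x , ∈⟪⟫⁺ pair? (inj₁ refl) , p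
    ... | inj₂ p = y , ∈⟪⟫⁺ pair? (inj₂ refl) , p

    unsplit : ∀ {u v z} → u ≢ z → v ≢ z → d u z ≡ d v z → ¬ Split G u v z
    unsplit _ _ eq (inj₁ (inj₁ (p , q))) = q (distance≡1⇒~ (trans (sym eq) (~⇒distance≡1 p)))
    unsplit _ _ eq (inj₁ (inj₂ (p , q))) = p (distance≡1⇒~ (trans eq (~⇒distance≡1 q)))
    unsplit u≢z _ eq (inj₂ (inj₁ (p , (_ , c₁ , c₂) , ¬c))) =
      ¬c (distance≡2⇒common (trans (sym eq) (common⇒distance≡2 u≢z p c₁ c₂)))
    unsplit _ v≢z eq (inj₂ (inj₂ (p , ¬c , (_ , c₁ , c₂)))) =
      ¬c (distance≡2⇒common (trans eq (common⇒distance≡2 v≢z p c₁ c₂)))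

    locating : Locating G conn D
    locating u v same with pair? u | pair? v
    ... | yes u∈ | _ = sym (distance≡0⇒≡ G conn
            (trans (sym (same u (∈⟪⟫⁺ pair? u∈))) (distance-refl G conn u)))
    ... | _ | yes v∈ = distance≡0⇒≡ G conn
            (trans (same v (∈⟪⟫⁺ pair? v∈)) (distance-refl G conn v))
    ... | no u∉ | no v∉ = decidable-stable (u ≟ v) λ u≢v →
            [ unsplit (u∉ ∘ inj₁) (v∉ ∘ inj₁) (same x (∈⟪⟫⁺ pair? (inj₁ refl)))
            , unsplit (u∉ ∘ inj₂) (v∉ ∘ inj₂) (same y (∈⟪⟫⁺ pair? (inj₂ refl))) ]′
            (sep u (u∉ ∘ inj₁) (u∉ ∘ inj₂) v (v∉ ∘ inj₁) (v∉ ∘ inj₂) u≢v)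

-- The search for graphs with η(G) = η(Ḡ) = 2

Six : ∀ {n} → (∀ {k} → Graph k → Graph n → Set) → Graph n → Set
Six R G = R P₅ G ⊎ R C₅ G ⊎ R bull G ⊎ R house G ⊎ R E G ⊎ R F G

module _ {m k} (H : Graph m) (G : Graph k) where

  IsIso : Vec (Fin k) m → Set
  IsIso g = (∀ i j → lookup g i ≡ lookup g j → i ≡ j)
          × (∀ i j → i ~[ H ] j → lookup g i ~[ G ] lookup g j)
          × (∀ i j → lookup g i ~[ G ] lookup g j → i ~[ H ] j)
          × (∀ v → ∃[ i ] lookup g i ≡ v)

  isIso? : Decidable IsIso
  isIso? g = (all? λ i → all? λ j → (lookup g i ≟ lookup g j) →-dec (i ≟ j))
       ×-dec (all? λ i → all? λ j → ~?[ H ] i j →-dec ~?[ G ] (lookup g i) (lookup g j))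
       ×-dec (all? λ i → all? λ j → ~?[ G ] (lookup g i) (lookup g j) →-dec ~?[ H ] i j)
       ×-dec (all? λ v → any? λ i → lookup g i ≟ v)

-- Backtracking: the image of vertex 0 must fit the images chosen for the later vertices, which
-- leaves few vectors for `isIso?`.
candidates : ∀ {m k} → Graph m → Graph k → List (Vec (Fin k) m)
candidates {zero}  H G = [ [] ]
candidates {suc m} {k} H G =
  concatMap (λ g → List.map (_∷ g) (filter (compatible? g) (allFin k))) (candidates (delete H) G)
  where
  compatible? : ∀ g → Decidable λ v → ∀ i → v ≢ lookup g i
                  × (zero ~[ H ] suc i → v ~[ G ] lookup g i)
                  × (v ~[ G ] lookup g i → zero ~[ H ] suc i)
  compatible? g v = all? λ i → ¬? (v ≟ lookup g i)
    ×-dec (~?[ H ] zero (suc i) →-dec ~?[ G ] v (lookup g i))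
    ×-dec (~?[ G ] v (lookup g i) →-dec ~?[ H ] zero (suc i))

Found : ∀ {m k} → Graph m → Graph k → Set
Found H G = Any (IsIso H G) (candidates H G)

found? : ∀ {m k} (H : Graph m) (G : Graph k) → Dec (Found H G)
found? H G = Any.any? (isIso? H G) (candidates H G)

found⇒≅ : ∀ {m k} {H : Graph m} {G : Graph k} → Found H G → H ≅ G
found⇒≅ {H = H} {G} found =
  let g , inj , pres , refl′ , onto = Any.satisfied found in
  surjective⇒≅ {H = H} {G = G}
    record { map = lookup g ; injective = inj _ _ ; preserve = pres _ _ ; reflect = refl′ _ _ } onto

Listed : ∀ {k} → Graph k → Set
Listed = Six Found

listed? : ∀ {k} (G : Graph k) → Dec (Listed G)
listed? G = found? P₅ G ⊎-dec found? C₅ G ⊎-dec found? bull G ⊎-dec found? house G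
  ⊎-dec found? E G ⊎-dec found? F G

-- H is an induced subgraph of G, and x, y and x′, y′ are metric-locating-dominating
-- pairs of G and its complement; fuel counts the vertices that may still be added.
data Search {k} (H : Graph k) (x y x′ y′ : Fin k) : ℕ → Set where
  step : ∀ {fuel} →
         (Weak H x y → Weak (complement H) x′ y′ →
             -- Used when H is all of G. Both graphs then have good triples, since otherwise the
             -- total would be 2n - 5, which exceeds 4.
             (5 ≤ k → GoodTriple H → GoodTriple (complement H) → Listed H)
           × (∀ r → Search (H ▸ r) (suc x) (suc y) (suc x′) (suc y′) fuel)) →
         Search H x y x′ y′ (suc fuel)

-- Takes the proof from a second copy of the decision, so that evaluating the truth value
-- does not keep the whole search tree reachable from the proof.
unshared : ∀ {A : Set} → (⊤ → Dec A) → Dec A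
unshared a? = does (a? tt) because proof (a? tt)

search? : ∀ fuel {k} (H : Graph k) x y x′ y′ → Dec (Search H x y x′ y′ fuel)
search? zero       H x y x′ y′ = no λ ()
search? (suc fuel) {k} H x y x′ y′ = unshared λ _ → map′ step (λ { (step s) → s })
  (weak? H x y →-dec weak? (complement H) x′ y′ →-dec
     ((5 ≤? k →-dec goodTriple? H →-dec goodTriple? (complement H) →-dec listed? H)
       ×-dec ∀vec? λ r → search? fuel (H ▸ r) (suc x) (suc y) (suc x′) (suc y′)))

opaque

  -- The three searches start from equal pairs, pairs sharing a vertex and disjoint pairs; earlier
  -- vertices have larger indices. Fuel is 8 minus the number of vertices. As `Search` is empty for
  -- fuel 0, the weak conditions must have failed at seven vertices at the latest.
  search-same : ∀ r → Search (empty ▸ [] ▸ r) (# 1) (# 0) (# 1) (# 0) 6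
  search-same = from-yes (∀vec? λ r → search? 6 (empty ▸ [] ▸ r) (# 1) (# 0) (# 1) (# 0))

  search-shared : ∀ r s → Search (empty ▸ [] ▸ r ▸ s) (# 2) (# 1) (# 2) (# 0) 5
  search-shared = from-yes (∀vec? λ r → ∀vec? λ s →
    search? 5 (empty ▸ [] ▸ r ▸ s) (# 2) (# 1) (# 2) (# 0))

  search-disjoint : ∀ r s t → Search (empty ▸ [] ▸ r ▸ s ▸ t) (# 3) (# 2) (# 1) (# 0) 4
  search-disjoint = from-yes (∀vec? λ r → ∀vec? λ s → ∀vec? λ t →
    search? 4 (empty ▸ [] ▸ r ▸ s ▸ t) (# 3) (# 2) (# 1) (# 0))

module _ {n} (G : Graph n) (5≤n : 5 ≤ n) (good : GoodTriple G) (good′ : GoodTriple (complement G)) where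

  -- The weak conditions descend from G to H. A vertex outside the embedding is the next one to add;
  -- if there is none, G is isomorphic to H and H is listed.
  search⇒six : ∀ {fuel k} {H : Graph k} {x y x′ y′} → Search H x y x′ y′ fuel → (e : Embedding H G) →
               Weak G (map e x) (map e y) → Weak (complement G) (map e x′) (map e y′) →
               Six (λ H G → G ≅ H) G
  search⇒six {k = k} {H} (step search) e weak weak′ =
    let final , next = search (weak-embedding e weak) (weak-embedding (complement-embedding e) weak′) in
    [ (λ (v , v∉) → search⇒six (next (neighbours e v)) (extend e v v∉) weak weak′)
    , (λ onto → listed⇒six (≅-sym (surjective⇒≅ e onto)) final)
    ]′ (outsider⊎onto (map e))
    where
    listed⇒six : G ≅ H → (5 ≤ k → GoodTriple H → GoodTriple (complement H) → Listed H) →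
                 Six (λ H G → G ≅ H) G
    listed⇒six G≅H final = Sum.map ≅P (Sum.map ≅P (Sum.map ≅P (Sum.map ≅P (Sum.map ≅P ≅P))))
      (final (subst (5 ≤_) (↔⇒≡ (_≅_.bijection G≅H)) 5≤n)
        (goodTriple-embedding (≅⇒embedding G≅H) good)
        (goodTriple-embedding (complement-embedding (≅⇒embedding G≅H)) good′))
      where
      ≅P : ∀ {m} {P : Graph m} → Found P H → G ≅ P
      ≅P found = ≅-trans G≅H (≅-sym (found⇒≅ found))

  private
    none : Embedding empty G
    none = record { map = λ () ; injective = λ { {()} } ; preserve = λ { {()} } ; reflect = λ { {()} } }

  shared-pairs⇒six : ∀ {x y y′} → x ≢ y → x ≢ y′ → Weak G x y → Weak (complement G) x y′ →
                     Six (λ H G → G ≅ H) G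
  shared-pairs⇒six {x} {y} {y′} x≢y x≢y′ weak weak′ with y′ ≟ y
  ... | yes refl = search⇒six (search-same (neighbours e₁ y)) e₂ weak weak′
    where
    e₁ = extend none x (λ ())
    e₂ = extend e₁ y λ { zero → ≢-sym x≢y }
  ... | no y′≢y = search⇒six (search-shared (neighbours e₁ y) (neighbours e₂ y′)) e₃ weak weak′
    where
    e₁ = extend none x (λ ())
    e₂ = extend e₁ y λ { zero → ≢-sym x≢y }
    e₃ = extend e₂ y′ λ { zero → y′≢y ; (suc zero) → ≢-sym x≢y′ }

  -- Swapping within the pairs brings a shared vertex to the front of both.
  weak-pairs⇒six : ∀ {x y x′ y′} → x ≢ y → x′ ≢ y′ → Weak G x y → Weak (complement G) x′ y′ →
                   Six (λ H G → G ≅ H) G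
  weak-pairs⇒six {x} {y} {x′} {y′} x≢y x′≢y′ weak weak′
    with x′ ≟ x | x′ ≟ y | y′ ≟ x | y′ ≟ y
  ... | yes refl | _ | _ | _ = shared-pairs⇒six x≢y x′≢y′ weak weak′
  ... | _ | yes refl | _ | _ = shared-pairs⇒six (≢-sym x≢y) x′≢y′ (weak-swap {G = G} weak) weak′
  ... | _ | _ | yes refl | _ = shared-pairs⇒six x≢y (≢-sym x′≢y′) weak (weak-swap {G = complement G} weak′)
  ... | _ | _ | _ | yes refl =
          shared-pairs⇒six (≢-sym x≢y) (≢-sym x′≢y′) (weak-swap {G = G} weak) (weak-swap {G = complement G} weak′)
  ... | no x′≢x | no x′≢y | no y′≢x | no y′≢y = search⇒six
          (search-disjoint (neighbours e₁ y) (neighbours e₂ x′) (neighbours e₃ y′)) e₄ weak weak′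
    where
    e₁ = extend none x (λ ())
    e₂ = extend e₁ y λ { zero → ≢-sym x≢y }
    e₃ = extend e₂ x′ λ { zero → x′≢y ; (suc zero) → x′≢x }
    e₄ = extend e₃ y′ λ { zero → ≢-sym x′≢y′ ; (suc zero) → y′≢y ; (suc (suc zero)) → y′≢x }

-- The six graphs attain the minimum

StrongPair : ∀ {n} → Graph n → Set
StrongPair G = ∃[ x ] ∃[ y ] Strong G x y

strongPair? : ∀ {n} (G : Graph n) → Dec (StrongPair G)
strongPair? G = any? λ x → any? λ y → strong? G x y

opaque

  six-strong : (StrongPair P₅ × StrongPair (complement P₅))
             × (StrongPair C₅ × StrongPair (complement C₅))
             × (StrongPair bull × StrongPair (complement bull))
             × (StrongPair house × StrongPair (complement house))
             × (StrongPair E × StrongPair (complement E))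
             × (StrongPair F × StrongPair (complement F))
  six-strong = from-yes (both? P₅ ×-dec both? C₅ ×-dec both? bull ×-dec both? house ×-dec both? E ×-dec both? F)
    where
    both? : ∀ {n} (H : Graph n) → Dec (StrongPair H × StrongPair (complement H))
    both? H = strongPair? H ×-dec strongPair? (complement H)

six⇒strong : ∀ {n} {G : Graph n} → Six (λ H G → G ≅ H) G → StrongPair G × StrongPair (complement G)
six⇒strong {G = G} six with six-strong
... | p , c , b , h , e , f =
  [ lift p , [ lift c , [ lift b , [ lift h , [ lift e , lift f ]′ ]′ ]′ ]′ ]′ six
  where
  lift : ∀ {m} {H : Graph m} → StrongPair H × StrongPair (complement H) → G ≅ H →
         StrongPair G × StrongPair (complement G)
  lift ((_ , _ , s) , (_ , _ , s′)) G≅H =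
    (_ , _ , strong-≅ G≅H s) , (_ , _ , strong-≅ (complement-≅ G≅H) s′)

-- Bounds for the sum and the cases of equality

StarPlusLike⁺ : ∀ {n} → Graph n → Set
StarPlusLike⁺ G = Σ (StarPlusLike G) λ (B , _) → ∃[ v ] (Blowup.κ B v ≡ # 1 × v ≢ Blowup.rep B (# 1))

goodTriple⊎like : ∀ {n} {G : Graph n} → Connected G → Embedding P₄ G →
                  GoodTriple G ⊎ DoubleStarLike G ⊎ StarPlusLike⁺ G
goodTriple⊎like {G = G} conn e with goodTriple? G
... | yes good = inj₁ good
... | no ¬good = inj₂ (Classify.classify conn ¬good e)

-- The summands are n - 2 and n - 3. Adding 5 on the left avoids truncated subtraction.
like⇒total : ∀ {n} {G H : Graph n} (conn : Connected G) (conn′ : Connected H) → 5 ≤ n → G ⇌ H →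
             DoubleStarLike G ⊎ StarPlusLike G → η G conn + η H conn′ + 5 ≡ 2 * n
like⇒total {n} {G} {H} conn conn′ 5≤n G⇌H like = begin
  η G conn + η H conn′ + 5         ≡⟨ [m+n]+5 (η G conn) (η H conn′) ⟩
  (η G conn + 2) + (η H conn′ + 3) ≡⟨ cong₂ _+_ ηG+2≡n ηH+3≡n ⟩
  n + n                            ≡⟨ cong (n +_) (sym (+-identityʳ n)) ⟩
  2 * n                            ∎
  where
  open ≡-Reasoning
  [m+n]+5 : ∀ m n → m + n + 5 ≡ (m + 2) + (n + 3)
  [m+n]+5 = solve-∀

  B : Blowup G
  B = [ proj₁ , proj₁ ]′ like

  ηG+2≡n : η G conn + 2 ≡ n
  ηG+2≡n = ≤-antisym (embedding⇒η+2≤n conn (Blowup.embedding B))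
    ([ doubleStarLike⇒≤η+2 conn , starPlusLike⇒≤η+2 conn ]′ like)

  ηH+3≡n : η H conn′ + 3 ≡ n
  ηH+3≡n = ≤-antisym
    (omittable⇒η H conn′ (proj₂ (proj₂ (proj₂ (blowup⇒complement-goodTriple 5≤n G⇌H B)))))
    ([ doubleStarLike⇒complement-≤η+3 conn′ G⇌H , starPlusLike⇒complement-≤η+3 conn′ G⇌H ]′ like)

≅-complement-sym : ∀ {m n} {G : Graph m} {H : Graph n} → complement G ≅ H → G ≅ complement H
≅-complement-sym {G = G} Ḡ≅H = ≅-trans (≅-sym (complement-complement-≅ G)) (complement-≅ Ḡ≅H)

complement-≅-sym : ∀ {m n} {G : Graph m} {H : Graph n} → G ≅ complement H → complement G ≅ H
complement-≅-sym {H = H} G≅H̄ = ≅-trans (complement-≅ G≅H̄) (complement-complement-≅ H)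

theorem4 : (n : ℕ) → 5 ≤ n → (G : Graph n) (dc : DoublyConnected G) →
    let open DoublyConnected dc
        total = η G connected + η (complement G) complement-connected
    in (4 ≤ total × total ≤ 2 * n ∸ 5)
     × (total ≡ 4 ⇔
          (G ≅ P₅ ⊎ G ≅ C₅ ⊎ G ≅ bull ⊎ G ≅ house ⊎ G ≅ E ⊎ G ≅ F))
     × (total ≡ 2 * n ∸ 5 ⇔
          ( (∃[ r ] ∃[ s ] (1 ≤ r × 1 ≤ s ×
               (G ≅ doubleStar r s ⊎ G ≅ complement (doubleStar r s))))
          ⊎ (∃[ r ] ∃[ s ] (2 ≤ s × s ≤ r ∸ 1 ×
               (G ≅ starPlus r s ⊎ G ≅ complement (starPlus r s))))))
theorem4 n 5≤n G dc =
    (4≤total , total≤)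
  , mk⇔ total≡4⇒six six⇒total≡4
  , mk⇔ total≡max⇒family family⇒total≡max
  where
  open DoublyConnected dc

  Ḡ : Graph n
  Ḡ = complement G

  ηG ηḠ total : ℕ
  ηG = η G connected
  ηḠ = η Ḡ complement-connected
  total = ηG + ηḠ

  Family : Set
  Family = (∃[ r ] ∃[ s ] (1 ≤ r × 1 ≤ s × (G ≅ doubleStar r s ⊎ G ≅ complement (doubleStar r s))))
         ⊎ (∃[ r ] ∃[ s ] (2 ≤ s × s ≤ r ∸ 1 × (G ≅ starPlus r s ⊎ G ≅ complement (starPlus r s))))

  GoodTriples : Set
  GoodTriples = GoodTriple G × GoodTriple Ḡ

  2≤ηG : 2 ≤ ηG
  2≤ηG = Distance.2≤η G connected (≤-trans (s≤s (s≤s (s≤s z≤n))) 5≤n)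

  2≤ηḠ : 2 ≤ ηḠ
  2≤ηḠ = Distance.2≤η Ḡ complement-connected (≤-trans (s≤s (s≤s (s≤s z≤n))) 5≤n)

  4≤total : 4 ≤ total
  4≤total = +-mono-≤ 2≤ηG 2≤ηḠ

  total+5⇒max : total + 5 ≡ 2 * n → total ≡ 2 * n ∸ 5
  total+5⇒max eq = trans (sym (m+n∸n≡m total 5)) (cong (_∸ 5) eq)

  likeG⇒max : DoubleStarLike G ⊎ StarPlusLike G → total ≡ 2 * n ∸ 5
  likeG⇒max like = total+5⇒max (like⇒total connected complement-connected 5≤n (⇌-complement G) like)

  likeḠ⇒max : DoubleStarLike Ḡ ⊎ StarPlusLike Ḡ → total ≡ 2 * n ∸ 5
  likeḠ⇒max like = total+5⇒max (trans (cong (_+ 5) (+-comm ηG ηḠ))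
    (like⇒total complement-connected connected 5≤n (⇌-sym (⇌-complement G)) like))

  -- Both summands are at most n - 3.
  good⇒< : GoodTriples → total < 2 * n ∸ 5
  good⇒< ((_ , _ , _ , o) , (_ , _ , _ , o′)) = m+n≤o⇒m≤o∸n (suc total) (begin
    suc total + 5         ≡⟨ regroup ηG ηḠ ⟩
    (ηG + 3) + (ηḠ + 3)   ≤⟨ +-mono-≤ (omittable⇒η G connected o) (omittable⇒η Ḡ complement-connected o′) ⟩
    n + n                 ≡⟨ cong (n +_) (sym (+-identityʳ n)) ⟩
    2 * n                 ∎)
    where
    open ≤-Reasoning
    regroup : ∀ a b → suc (a + b) + 5 ≡ (a + 3) + (b + 3)
    regroup = solve-∀

  P₄⊆G : Embedding P₄ G
  P₄⊆G = InducedP₄⇒embedding (doublyConnected⇒InducedP₄ (≤-trans (s≤s (s≤s z≤n)) 5≤n) dc)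

  cases : (total ≡ 2 * n ∸ 5 × Family) ⊎ GoodTriples
  cases with goodTriple⊎like connected P₄⊆G
           -- The complement contains P₄ because P₄ is self-complementary.
           | goodTriple⊎like complement-connected (∘-embedding (complement-embedding P₄⊆G) P₄-self-complementary)
  ... | inj₂ (inj₁ double) | _ = inj₁ (likeG⇒max (inj₁ double) ,
          let r , s , 1≤r , 1≤s , iso = doubleStarLike⇒≅ double in
          inj₁ (r , s , 1≤r , 1≤s , inj₁ iso))
  ... | inj₂ (inj₂ (star , extra)) | _ = inj₁ (likeG⇒max (inj₂ star) ,
          let r , s , 2≤s , s≤r , iso = starPlusLike⇒≅ star extra in
          inj₂ (r , s , 2≤s , s≤r , inj₁ iso))
  ... | _ | inj₂ (inj₁ double) = inj₁ (likeḠ⇒max (inj₁ double) ,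
          let r , s , 1≤r , 1≤s , iso = doubleStarLike⇒≅ double in
          inj₁ (r , s , 1≤r , 1≤s , inj₂ (≅-complement-sym iso)))
  ... | _ | inj₂ (inj₂ (star , extra)) = inj₁ (likeḠ⇒max (inj₂ star) ,
          let r , s , 2≤s , s≤r , iso = starPlusLike⇒≅ star extra in
          inj₂ (r , s , 2≤s , s≤r , inj₂ (≅-complement-sym iso)))
  ... | inj₁ good | inj₁ good′ = inj₂ (good , good′)

  total≤ : total ≤ 2 * n ∸ 5
  total≤ = [ (λ (max , _) → ≤-reflexive max) , <⇒≤ ∘ good⇒< ]′ cases

  total≡4⇒six : total ≡ 4 → Six (λ H G → G ≅ H) G
  total≡4⇒six eq with cases
  -- For n ≥ 5 the value 2n - 5 is at least 5.
  ... | inj₁ (max , _) = contradiction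
          (subst (5 ≤_) (trans (sym max) eq) (∸-monoˡ-≤ 5 (*-monoʳ-≤ 2 5≤n))) λ { (s≤s (s≤s (s≤s (s≤s ())))) }
  ... | inj₂ (good , good′) =
    let x , y , x≢y , weak = η≡2⇒weak connected
          (≤-antisym (+-cancelʳ-≤ 2 ηG 2 (subst (ηG + 2 ≤_) eq (+-monoʳ-≤ ηG 2≤ηḠ))) 2≤ηG)
        x′ , y′ , x′≢y′ , weak′ = η≡2⇒weak complement-connected
          (≤-antisym (+-cancelˡ-≤ 2 ηḠ 2 (subst (2 + ηḠ ≤_) eq (+-monoˡ-≤ ηḠ 2≤ηG))) 2≤ηḠ)
    in weak-pairs⇒six G 5≤n good good′ x≢y x′≢y′ weak weak′

  six⇒total≡4 : Six (λ H G → G ≅ H) G → total ≡ 4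
  six⇒total≡4 six =
    let (_ , _ , strong) , (_ , _ , strong′) = six⇒strong six in
    ≤-antisym (+-mono-≤ (strong⇒η≤2 connected strong) (strong⇒η≤2 complement-connected strong′)) 4≤total

  total≡max⇒family : total ≡ 2 * n ∸ 5 → Family
  total≡max⇒family eq = [ proj₂ , (λ good → contradiction eq (<⇒≢ (good⇒< good))) ]′ cases

  family⇒total≡max : Family → total ≡ 2 * n ∸ 5
  family⇒total≡max (inj₁ (r , s , 1≤r , 1≤s , inj₁ iso)) = likeG⇒max (inj₁ (≅⇒doubleStarLike 1≤r 1≤s iso))
  family⇒total≡max (inj₁ (r , s , 1≤r , 1≤s , inj₂ iso)) =
    likeḠ⇒max (inj₁ (≅⇒doubleStarLike 1≤r 1≤s (complement-≅-sym iso)))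
  family⇒total≡max (inj₂ (r , s , 2≤s , s≤r , inj₁ iso)) = likeG⇒max (inj₂ (≅⇒starPlusLike 2≤s s≤r iso))
  family⇒total≡max (inj₂ (r , s , 2≤s , s≤r , inj₂ iso)) =
    likeḠ⇒max (inj₂ (≅⇒starPlusLike 2≤s s≤r (complement-≅-sym iso)))
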